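{- Let $D=(V,A)$ be a tournament. For each $\sigma\in\mathfrak{S}_V$ let $\psi(\sigma)$ denote the number of nontrivial cycles of $\sigma$. Then \[U_D=\sum_{\substack{\sigma\in\mathfrak{S}_V(D);\\ \text{all cycles of }\sigma\text{ have odd length}}}2^{\psi(\sigma)}\,p_{\operatorname{type}\sigma}.\]
   Context: A tournament is a digraph $D=(V,A)$ ($V$ finite, $A\subseteq V\times V$) with $(u,u)\notin A$ for all $u$ and such that for any two distinct $u,v\in V$ exactly one of $(u,v),(v,u)$ lies in $A$. Let $n=|V|$. A $V$-listing is a tuple $w=(w_1,\dots,w_n)$ containing each element of $V$ exactly once; $\operatorname{Des}(w,D)=\{i\in[n-1]:(w_i,w_{i+1})\in A\}$; $L_{I,n}=\sum x_{i_1}\cdots x_{i_n}$ over positive integers $i_1\le\cdots\le i_n$ with $i_p<i_{p+1}$ for $p\in I$; $U_D=\sum_w L_{\operatorname{Des}(w,D),n}$ over all $V$-listings. Cycles of $\sigma\in\mathfrak{S}_V$ are the rotation-equivalence classes of tuples $(i,\sigma(i),\dots,\sigma^{k-1}(i))$ with $k$ minimal such that $\sigma^k(i)=i$; a cycle is nontrivial if its length exceeds $1$. For the class $\gamma$ of $(v_1,\dots,v_k)$, $\operatorname{CArcs}\gamma=\{(v_1,v_2),\dots,(v_{k-1},v_k),(v_k,v_1)\}$; a $D$-cycle is a rotation-equivalence class $\gamma$ of nonempty tuples of distinct vertices with $\operatorname{CArcs}\gamma\subseteq A$. $\mathfrak{S}_V(D)$ is the set of $\sigma\in\mathfrak{S}_V$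 each of whose nontrivial cycles is a $D$-cycle. $\operatorname{type}\sigma$ is the partition of cycle lengths; $p_k=\sum_i x_i^k$, $p_\lambda=\prod_j p_{\lambda_j}$. -}

module Defs where

open import Level using (Level)
open import Data.Nat using (ℕ; zero; suc; _<ᵇ_; _≤ᵇ_; _^_)
open import Data.Fin using (Fin; toℕ)
open import Data.Fin.Properties using () renaming (_≟_ to _≟ᶠ_)
open import Data.Bool using (Bool; true; false; _∧_; not; if_then_else_)
open import Data.List using (List; []; _∷_; map; concatMap; foldr; length; upTo; allFin)
open import Data.Vec using (Vec; lookup; toList) renaming ([] to []ᵛ; _∷_ to _∷ᵛ_)
open import Data.Product using (_×_)
open import Relation.Nullary using (does)
open import Relation.Binary.PropositionalEquality using (_≡_; _≢_)
open import Algebra.Bundles using (CommutativeSemiring)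

eqᶠ : ∀ {n} → Fin n → Fin n → Bool
eqᶠ i j = does (i ≟ᶠ j)

filterᵇ : ∀ {a} {A : Set a} → (A → Bool) → List A → List A
filterᵇ p [] = []
filterᵇ p (x ∷ xs) = if p x then x ∷ filterᵇ p xs else filterᵇ p xs

allᵇ : ∀ {a} {A : Set a} → (A → Bool) → List A → Bool
allᵇ p [] = true
allᵇ p (x ∷ xs) = p x ∧ allᵇ p xs

anyᵇ : ∀ {a} {A : Set a} → (A → Bool) → List A → Bool
anyᵇ p [] = false
anyᵇ p (x ∷ xs) = if p x then true else anyᵇ p xs

takeWhileᵇ : ∀ {a} {A : Set a} → (A → Bool) → List A → List A
takeWhileᵇ p [] = []
takeWhileᵇ p (x ∷ xs) = if p x then x ∷ takeWhileᵇ p xs else []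

isOdd : ℕ → Bool
isOdd zero = false
isOdd (suc k) = not (isOdd k)

vecs : ∀ {a} {A : Set a} → List A → (k : ℕ) → List (Vec A k)
vecs xs zero = []ᵛ ∷ []
vecs xs (suc k) = concatMap (λ a → map (a ∷ᵛ_) (vecs xs k)) xs

distinct : ∀ {n} → List (Fin n) → Bool
distinct [] = true
distinct (x ∷ xs) = not (anyᵇ (eqᶠ x) xs) ∧ distinct xs

-- Vertex set V = Fin n.  A V-listing is a tuple (w₁,…,wₙ) containing
-- each vertex exactly once.  The same tuples also encode the
-- permutations σ ∈ 𝔖_V via σ(i) = lookup σ i.

listings : (n : ℕ) → List (Vec (Fin n) n)
listings n = filterᵇ (λ w → distinct (toList w)) (vecs (allFin n) n)

Digraph : ℕ → Set
Digraph n = Fin n → Fin n → Bool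

IsTournament : ∀ {n} → Digraph n → Set
IsTournament {n} D =
  ((u : Fin n) → D u u ≡ false) ×
  ((u v : Fin n) → u ≢ v → D u v ≡ not (D v u))

-- Des(w, D) as a predicate on positions p ∈ ℕ (1-based):
-- p ∈ Des iff 1 ≤ p ≤ n-1 and (w_p, w_{p+1}) ∈ A.
des : ∀ {n} → Digraph n → List (Fin n) → ℕ → Bool
des D (a ∷ b ∷ r) (suc zero) = D a b
des D (a ∷ r) (suc (suc p)) = des D r (suc p)
des D _ _ = false

-- A sequence i₁ … iₙ (of variable indices in Fin m) is admissible for I
-- iff i₁ ≤ ⋯ ≤ iₙ and i_p < i_{p+1} for p ∈ I (positions 1-based).
admissible : ∀ {m} → (ℕ → Bool) → List (Fin m) → Bool
admissible I (i ∷ j ∷ r) =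
  (if I 1 then toℕ i <ᵇ toℕ j else toℕ i ≤ᵇ toℕ j)
  ∧ admissible (λ p → I (suc p)) (j ∷ r)
admissible I _ = true

-- Cycles of a permutation σ (given as a listing, σ(i) = lookup σ i).
-- Each cycle is represented by the rotation starting at its least
-- element i, i.e. (i, σ i, …, σ^{k-1} i) with k the cycle length.

iter : ∀ {n} → Vec (Fin n) n → ℕ → Fin n → Fin n
iter σ zero i = i
iter σ (suc k) i = lookup σ (iter σ k i)

cycLen : ∀ {n} → Vec (Fin n) n → Fin n → ℕ
cycLen {n} σ i =
  suc (length (takeWhileᵇ (λ v → not (eqᶠ v i))
                          (map (λ k → iter σ (suc k) i) (upTo n))))

isRep : ∀ {n} → Vec (Fin n) n → Fin n → Bool
isRep {n} σ i = allᵇ (λ k → toℕ i ≤ᵇ toℕ (iter σ k i)) (upTo n)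

reps : ∀ {n} → Vec (Fin n) n → List (Fin n)
reps {n} σ = filterᵇ (isRep σ) (allFin n)

cycleType : ∀ {n} → Vec (Fin n) n → List ℕ
cycleType σ = map (cycLen σ) (reps σ)

ψ : ∀ {n} → Vec (Fin n) n → ℕ
ψ σ = length (filterᵇ (λ k → 1 <ᵇ k) (cycleType σ))

allCyclesOdd : ∀ {n} → Vec (Fin n) n → Bool
allCyclesOdd σ = allᵇ isOdd (cycleType σ)

isDCycle : ∀ {n} → Digraph n → Vec (Fin n) n → Fin n → Bool
isDCycle D σ i =
  allᵇ (λ k → D (iter σ k i) (iter σ (suc k) i)) (upTo (cycLen σ i))

inSD : ∀ {n} → Digraph n → Vec (Fin n) n → Bool
inSD D σ = allᵇ (λ i → if 1 <ᵇ cycLen σ i then isDCycle D σ i else true) (reps σ)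

-- Evaluation of the symmetric functions at x₁,…,x_m (x_{m+1} = ⋯ = 0)
-- in an arbitrary commutative semiring.

module Eval {c ℓ : Level} (R : CommutativeSemiring c ℓ) where
  open CommutativeSemiring R

  sumR : List Carrier → Carrier
  sumR = foldr _+_ 0#

  prodR : List Carrier → Carrier
  prodR = foldr _*_ 1#

  powR : Carrier → ℕ → Carrier
  powR x zero = 1#
  powR x (suc k) = x * powR x k

  natR : ℕ → Carrier
  natR zero = 0#
  natR (suc k) = 1# + natR k

  L : ∀ {m} → (Fin m → Carrier) → (ℕ → Bool) → ℕ → Carrier
  L {m} x I n =
    sumR (map (λ s → if admissible I (toList s)
                       then prodR (map x (toList s)) else 0#)
              (vecs (allFin m) n))

  U : ∀ {n m} → Digraph n → (Fin m → Carrier) → Carrier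
  U {n} D x = sumR (map (λ w → L x (des D (toList w)) n) (listings n))

  p : ∀ {m} → (Fin m → Carrier) → ℕ → Carrier
  p {m} x k = sumR (map (λ j → powR (x j) k) (allFin m))

  pType : ∀ {m} → (Fin m → Carrier) → List ℕ → Carrier
  pType x λs = prodR (map (p x) λs)

  RHS : ∀ {n m} → Digraph n → (Fin m → Carrier) → Carrier
  RHS {n} D x =
    sumR (map (λ σ → natR (2 ^ ψ σ) * pType x (cycleType σ))
              (filterᵇ (λ σ → inSD D σ ∧ allCyclesOdd σ) (listings n)))

{-# OPTIONS --safe #-}
module Submission where

-- Functions on lists are regarded as elements of the shuffle algebra (the product is splitSum),
-- where f ↦ f (v ∷_) is a derivation.  Grouping the vertices of a listing by their variable
-- writes U_D as a product, over the variables x_j, of the functions S ↦ N(S) x_j^|S|, where N(S)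
-- counts the listings of S without descents.  It therefore suffices to know the derivative of N.
-- For a matrix e = 1 + b, expanding the e-weight of a listing by the last factor from which 1 is
-- chosen gives N(v ∷ S) = Σ_C κ(v ∷ C) N(S ∖ C), where κ sums Π e − Π b over the cyclic orders.
-- For b = −[D], reversing the cycles of non-arcs of a tournament turns them into D-cycles, so
-- that even cycles cancel and odd nontrivial ones count twice.  Hence U_D satisfies
-- U(v ∷ S) = Σ_C κ(v ∷ C) p_{1+|C|} U(S ∖ C), which is also the recursion obtained on the
-- right-hand side by splitting off the cycle of v.

open import Defs
open import Level using (Level; 0ℓ)
open import Algebra.Bundles using (CommutativeSemiring)
open import Data.Bool using (Bool; true; false; _∧_; not; if_then_else_)
open import Data.Bool.Properties using (T-≡; ∧-zeroʳ; ∧-identityʳ)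
open import Data.Fin as Fin using (Fin; zero; suc; toℕ)
open import Data.Fin.Properties using () renaming (_≟_ to _≟ᶠ_)
open import Data.Integer as ℤ using (ℤ; +_)
import Data.Integer.Properties as ℤₚ
open import Data.List using (List; []; _∷_; _++_; map; length; reverse; filter; concat; concatMap; allFin; tabulate; upTo; applyUpTo)
open import Data.List.Properties using (∷-injectiveˡ; ∷-injectiveʳ; ++-assoc; unfold-reverse; filter-all; filter-accept; filter-reject; length-++; length-map; length-tabulate; map-++; map-∘; map-tabulate; map-cong-local; map-id-local; map-upTo)
open import Data.List.Membership.Propositional using (_∈_; _∉_; find; lose)
open import Data.List.Membership.Propositional.Properties using (∈-map⁺; ∈-map⁻; ∈-∃++; ∈-concatMap⁺; ∈-concatMap⁻; ∈-allFin; ∈-upTo⁺)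
open import Data.List.Membership.Propositional.Properties.WithK using (unique∧set⇒bag)
open import Data.List.Relation.Binary.BagAndSetEquality using (∼bag⇒↭)
open import Data.List.Relation.Binary.Permutation.Propositional as ↭ using (_↭_; prep; ↭-refl; ↭-reflexive; ↭-sym; ↭-trans; ↭⇒↭ₛ)
open import Data.List.Relation.Binary.Permutation.Propositional.Properties using (↭-length; shift; ∈-resp-↭; All-resp-↭; drop-mid; ↭-empty-inv; ++⁺; map⁺; ∷↭∷ʳ)
import Data.List.Relation.Binary.Permutation.Setoid.Properties as ↭ₛ
open import Data.List.Relation.Binary.Subset.Propositional using (_⊆_)
open import Data.List.Relation.Ternary.Interleaving.Propositional using (Interleaving; []; consˡ; consʳ; swap; toPermutation)
open import Data.List.Relation.Unary.All as All using (All; []; _∷_)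
import Data.List.Relation.Unary.All.Properties as Allₚ
open import Data.List.Relation.Unary.AllPairs using (AllPairs; []; _∷_)
import Data.List.Relation.Unary.AllPairs.Properties as AllPairsₚ
open import Data.List.Relation.Unary.Any using (here; there)
open import Data.List.Relation.Unary.Unique.Propositional using (Unique)
import Data.List.Relation.Unary.Unique.Propositional.Properties as Uniqueₚ
open import Data.Nat as ℕ using (ℕ; zero; suc; _≤_; _<_; s≤s; _<ᵇ_; _≤ᵇ_; _^_)
import Data.Nat.Properties as ℕₚ
open import Data.Product using (_×_; _,_; proj₁; proj₂; ∃)
open import Data.Vec as Vec using (Vec; toList; lookup) renaming ([] to []ᵛ; _∷_ to _∷ᵛ_)
import Data.Vec.Properties as Vecₚ
open import Function using (_∘_; mk⇔; Equivalence)
open import Relation.Binary.Definitions using (DecidableEquality)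
open import Relation.Binary.PropositionalEquality as ≡ using (_≡_; _≢_; refl; cong; cong₂; sym; trans; subst)
open import Relation.Nullary using (¬_; yes; no; contradiction; ¬?)
open import Relation.Unary using (Decidable)

-- The identity is claimed in an arbitrary commutative semiring, while b = -[D] has negative
-- entries. So the expansion is stated without subtraction, applied over ℤ, where the all-b cycles
-- can be cancelled, brought back to ℕ by the injectivity of ℕ → ℤ, and sent by `natR` into the
-- given semiring.
--
-- The power sums come from a logarithmic derivative. Removing v from the factor of one variable
-- multiplies that factor by a sum over the cycles through v, weighted with x_j^(1+|C|). By the
-- Leibniz rule the product over all variables is multiplied by the sum of these expressions, and
-- the powers add up to p_(1+|C|).
--
-- On duplicate-free lists the recursion, with the value 1 at the empty list, has one solution: the
-- sum over cycle structures of the products of cycle weights. To match cycle structures with the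
-- permutations on the right-hand side, an injection is combined with a count, and the count is the
-- same recursion with all weights equal to 1.

private variable
  A B : Set
  n : ℕ

-- The shuffle algebra

module ShuffleAlgebra {c ℓ : Level} (R : CommutativeSemiring c ℓ) where
  open CommutativeSemiring R hiding (zero; refl; sym; trans) renaming (Carrier to K)
  open CommutativeSemiring R using () renaming (refl to ≈-refl; sym to ≈-sym; trans to ≈-trans)
  open import Algebra.Solver.Ring.NaturalCoefficients.Default R using (solve; _:+_; _:*_; _:=_; con)
  open import Relation.Binary.Reasoning.Setoid setoid

  insSum : A → (List A → K) → List A → K
  insSum x F [] = F (x ∷ [])
  insSum x F (y ∷ ys) = F (x ∷ y ∷ ys) + insSum x (λ z → F (y ∷ z)) ys

  -- The weight changes along the recursion instead of a list of arrangements being built, so that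
  -- identities follow by induction on the list with the weight generalised. `permSum-perms` gives
  -- the enumerated form.
  permSum : (List A → K) → List A → K
  permSum F [] = F []
  permSum F (x ∷ S) = permSum (insSum x F) S

  cutSum : (List A → K) → (List A → K) → List A → K
  cutSum F G [] = F [] * G []
  cutSum F G (y ∷ ys) = F [] * G (y ∷ ys) + cutSum (λ z → F (y ∷ z)) G ys

  -- The shuffle product: the sum of f A * g B over the ways of distributing
  -- the entries of the list over A and B.
  splitSum : (List A → K) → (List A → K) → List A → K
  splitSum f g [] = f [] * g []
  splitSum f g (x ∷ S) = splitSum (λ A → f (x ∷ A)) g S + splitSum f (λ B → g (x ∷ B)) S

  insSum-cong-↭ : {F G : List A → K} {x : A} (y : List A) →
    (∀ z → z ↭ x ∷ y → F z ≈ G z) → insSum x F y ≈ insSum x G y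
  insSum-cong-↭ [] h = h _ ↭-refl
  insSum-cong-↭ {x = x} (y ∷ ys) h =
    +-cong (h _ ↭-refl)
           (insSum-cong-↭ ys (λ z z↭ → h (y ∷ z) (↭-trans (prep y z↭) (↭.swap y x ↭-refl))))

  permSum-cong-↭ : {F G : List A → K} (S : List A) →
    (∀ z → z ↭ S → F z ≈ G z) → permSum F S ≈ permSum G S
  permSum-cong-↭ [] h = h [] ↭-refl
  permSum-cong-↭ (x ∷ S) h =
    permSum-cong-↭ S (λ y y↭S → insSum-cong-↭ y (λ z z↭ → h z (↭-trans z↭ (prep x y↭S))))

  insSum-cong : {F G : List A → K} {x : A} → (∀ z → F z ≈ G z) →
    ∀ y → insSum x F y ≈ insSum x G y
  insSum-cong h y = insSum-cong-↭ y (λ z _ → h z)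

  permSum-cong : {F G : List A → K} → (∀ z → F z ≈ G z) → ∀ S → permSum F S ≈ permSum G S
  permSum-cong h S = permSum-cong-↭ S (λ z _ → h z)

  insSum-+ : (F G : List A → K) (x : A) (y : List A) →
    insSum x (λ z → F z + G z) y ≈ insSum x F y + insSum x G y
  insSum-+ F G x [] = ≈-refl
  insSum-+ F G x (y ∷ ys) = begin
    F _ + G _ + insSum x (λ z → F (y ∷ z) + G (y ∷ z)) ys
      ≈⟨ +-congˡ (insSum-+ _ _ x ys) ⟩
    F _ + G _ + (insSum x (λ z → F (y ∷ z)) ys + insSum x (λ z → G (y ∷ z)) ys)
      ≈⟨ solve 4 (λ a b c d → a :+ b :+ (c :+ d) := a :+ c :+ (b :+ d)) ≈-refl _ _ _ _ ⟩
    _ ∎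

  permSum-+ : (F G : List A → K) (S : List A) →
    permSum (λ z → F z + G z) S ≈ permSum F S + permSum G S
  permSum-+ F G [] = ≈-refl
  permSum-+ F G (x ∷ S) = ≈-trans (permSum-cong (insSum-+ F G x) S) (permSum-+ _ _ S)

  insSum-*ʳ : (F : List A → K) (k : K) (x : A) (y : List A) →
    insSum x (λ z → F z * k) y ≈ insSum x F y * k
  insSum-*ʳ F k x [] = ≈-refl
  insSum-*ʳ F k x (y ∷ ys) = ≈-trans (+-congˡ (insSum-*ʳ _ k x ys)) (≈-sym (distribʳ k _ _))

  insSum-*ˡ : (F : List A → K) (k : K) (x : A) (y : List A) →
    insSum x (λ z → k * F z) y ≈ k * insSum x F y
  insSum-*ˡ F k x y =
    ≈-trans (insSum-cong (λ _ → *-comm k _) y) (≈-trans (insSum-*ʳ F k x y) (*-comm _ k))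

  permSum-*ʳ : (F : List A → K) (k : K) (S : List A) →
    permSum (λ z → F z * k) S ≈ permSum F S * k
  permSum-*ʳ F k [] = ≈-refl
  permSum-*ʳ F k (x ∷ S) = ≈-trans (permSum-cong (insSum-*ʳ F k x) S) (permSum-*ʳ _ k S)

  permSum-length : (F : List A → K) (g : ℕ → K) (S : List A) →
    permSum (λ z → F z * g (length z)) S ≈ permSum F S * g (length S)
  permSum-length F g S =
    ≈-trans (permSum-cong-↭ S (λ z z↭S → *-congˡ (reflexive (cong g (↭-length z↭S)))))
          (permSum-*ʳ F _ S)

  cutSum-congˡ : {F F′ : List A → K} {G : List A → K} → (∀ z → F z ≈ F′ z) →
    ∀ y → cutSum F G y ≈ cutSum F′ G y
  cutSum-congˡ h [] = *-congʳ (h [])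
  cutSum-congˡ h (y ∷ ys) = +-cong (*-congʳ (h [])) (cutSum-congˡ (λ z → h (y ∷ z)) ys)

  cutSum-+ˡ : (F F′ G : List A → K) (y : List A) →
    cutSum (λ z → F z + F′ z) G y ≈ cutSum F G y + cutSum F′ G y
  cutSum-+ˡ F F′ G [] = distribʳ _ _ _
  cutSum-+ˡ F F′ G (y ∷ ys) = ≈-trans (+-congˡ (cutSum-+ˡ _ _ G ys))
    (solve 5 (λ a b c d e → (a :+ b) :* c :+ (d :+ e) := a :* c :+ d :+ (b :* c :+ e)) ≈-refl _ _ _ _ _)

  cutSum-*ˡ : (F G : List A → K) (k : K) (y : List A) →
    cutSum (λ z → k * F z) G y ≈ k * cutSum F G y
  cutSum-*ˡ F G k [] = *-assoc _ _ _
  cutSum-*ˡ F G k (y ∷ ys) = ≈-trans (+-congˡ (cutSum-*ˡ _ G k ys))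
    (solve 4 (λ a b c d → a :* b :* c :+ a :* d := a :* (b :* c :+ d)) ≈-refl _ _ _ _)

  splitSum-cong : {f f′ g g′ : List A → K} (S : List A) →
    (∀ A B → Interleaving A B S → f A * g B ≈ f′ A * g′ B) →
    splitSum f g S ≈ splitSum f′ g′ S
  splitSum-cong [] h = h [] [] []
  splitSum-cong (x ∷ S) h =
    +-cong (splitSum-cong S (λ A B i → h _ _ (consˡ i))) (splitSum-cong S (λ A B i → h _ _ (consʳ i)))

  splitSum-congˡ : {f f′ g : List A → K} → (∀ z → f z ≈ f′ z) → ∀ S → splitSum f g S ≈ splitSum f′ g S
  splitSum-congˡ h S = splitSum-cong S (λ A B _ → *-congʳ (h A))

  splitSum-congʳ : {f g g′ : List A → K} → (∀ z → g z ≈ g′ z) → ∀ S → splitSum f g S ≈ splitSum f g′ S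
  splitSum-congʳ h S = splitSum-cong S (λ A B _ → *-congˡ (h B))

  splitSum-comm : (f g : List A → K) (S : List A) → splitSum f g S ≈ splitSum g f S
  splitSum-comm f g [] = *-comm _ _
  splitSum-comm f g (x ∷ S) = ≈-trans (+-cong (splitSum-comm _ g S) (splitSum-comm f _ S)) (+-comm _ _)

  splitSum-+ˡ : (f f′ g : List A → K) (S : List A) →
    splitSum (λ z → f z + f′ z) g S ≈ splitSum f g S + splitSum f′ g S
  splitSum-+ˡ f f′ g [] = distribʳ _ _ _
  splitSum-+ˡ f f′ g (x ∷ S) = ≈-trans (+-cong (splitSum-+ˡ _ _ g S) (splitSum-+ˡ f f′ _ S))
    (solve 4 (λ a b c d → a :+ b :+ (c :+ d) := a :+ c :+ (b :+ d)) ≈-refl _ _ _ _)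

  splitSum-+ʳ : (f g g′ : List A → K) (S : List A) →
    splitSum f (λ z → g z + g′ z) S ≈ splitSum f g S + splitSum f g′ S
  splitSum-+ʳ f g g′ S = ≈-trans (splitSum-comm f _ S)
    (≈-trans (splitSum-+ˡ g g′ f S) (+-cong (splitSum-comm g f S) (splitSum-comm g′ f S)))

  splitSum-*ʳ : (f g : List A → K) (k : K) (S : List A) →
    splitSum f g S * k ≈ splitSum (λ z → f z * k) g S
  splitSum-*ʳ f g k [] = solve 3 (λ a b c → a :* b :* c := a :* c :* b) ≈-refl _ _ _
  splitSum-*ʳ f g k (x ∷ S) =
    ≈-trans (distribʳ k _ _) (+-cong (splitSum-*ʳ _ g k S) (splitSum-*ʳ f _ k S))

  -- Under the Leibniz rule both sides unfold to the same three terms, according to which of the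
  -- three factors takes `x`.
  splitSum-assoc : (f g h : List A → K) (S : List A) →
    splitSum (splitSum f g) h S ≈ splitSum f (splitSum g h) S
  splitSum-assoc f g h [] = *-assoc _ _ _
  splitSum-assoc f g h (x ∷ S) = begin
    splitSum (λ A → splitSum f↓ g A + splitSum f g↓ A) h S + splitSum (splitSum f g) h↓ S
      ≈⟨ +-congʳ (splitSum-+ˡ _ _ h S) ⟩
    splitSum (splitSum f↓ g) h S + splitSum (splitSum f g↓) h S + splitSum (splitSum f g) h↓ S
      ≈⟨ +-cong (+-cong (splitSum-assoc f↓ g h S) (splitSum-assoc f g↓ h S)) (splitSum-assoc f g h↓ S) ⟩
    splitSum f↓ (splitSum g h) S + splitSum f (splitSum g↓ h) S + splitSum f (splitSum g h↓) S
      ≈⟨ +-assoc _ _ _ ⟩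
    splitSum f↓ (splitSum g h) S + (splitSum f (splitSum g↓ h) S + splitSum f (splitSum g h↓) S)
      ≈⟨ +-congˡ (splitSum-+ʳ f _ _ S) ⟨
    splitSum f↓ (splitSum g h) S + splitSum f (λ B → splitSum g↓ h B + splitSum g h↓ B) S ∎
    where
    f↓ g↓ h↓ : List _ → K
    f↓ z = f (x ∷ z)
    g↓ z = g (x ∷ z)
    h↓ z = h (x ∷ z)

  splitSum-left-comm : (f g h : List A → K) (S : List A) →
    splitSum f (splitSum g h) S ≈ splitSum g (splitSum f h) S
  splitSum-left-comm f g h S = begin
    splitSum f (splitSum g h) S ≈⟨ splitSum-assoc f g h S ⟨
    splitSum (splitSum f g) h S ≈⟨ splitSum-congˡ (splitSum-comm f g) S ⟩
    splitSum (splitSum g f) h S ≈⟨ splitSum-assoc g f h S ⟩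
    splitSum g (splitSum f h) S ∎

  -- Every cut of the enlarged list has the new entry on exactly one side. An insertion at the cut
  -- itself occurs twice, at the end of the left part and at the front of the right part.
  insSum-cutSum : (F G : List A → K) (x : A) (y : List A) →
    insSum x (cutSum F G) y ≈ cutSum (insSum x F) G y + cutSum F (insSum x G) y
  insSum-cutSum F G x [] = +-comm _ _
  insSum-cutSum F G x (y ∷ ys) = begin
    F [] * G (x ∷ y ∷ ys) + (F (x ∷ []) * G (y ∷ ys) + cutSum (λ z → F (x ∷ y ∷ z)) G ys)
      + insSum x (λ z → F [] * G (y ∷ z) + cutSum F↓ G z) ys
      ≈⟨ +-congˡ (≈-trans (insSum-+ _ _ x ys) (+-cong (insSum-*ˡ _ _ x ys) (insSum-cutSum F↓ G x ys))) ⟩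
    F [] * G (x ∷ y ∷ ys) + (F (x ∷ []) * G (y ∷ ys) + cutSum (λ z → F (x ∷ y ∷ z)) G ys)
      + (F [] * insSum x (λ z → G (y ∷ z)) ys + (cutSum (insSum x F↓) G ys + cutSum F↓ (insSum x G) ys))
      ≈⟨ solve 8 (λ a b c d e f g h → a :* b :+ (c :* d :+ e) :+ (a :* f :+ (g :+ h))
                    := c :* d :+ (e :+ g) :+ (a :* (b :+ f) :+ h)) ≈-refl _ _ _ _ _ _ _ _ ⟩
    F (x ∷ []) * G (y ∷ ys) + (cutSum (λ z → F (x ∷ y ∷ z)) G ys + cutSum (insSum x F↓) G ys)
      + (F [] * (G (x ∷ y ∷ ys) + insSum x (λ z → G (y ∷ z)) ys) + cutSum F↓ (insSum x G) ys)
      ≈⟨ +-congʳ (+-congˡ (cutSum-+ˡ _ _ G ys)) ⟨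
    _ ∎
    where
    F↓ : List _ → K
    F↓ z = F (y ∷ z)

  -- `insSum x` acts on cut products by the same Leibniz rule by which `splitSum` is defined, so
  -- inserting all entries turns one product into the other.
  permSum-cutSum : (F G : List A → K) (S : List A) →
    permSum (cutSum F G) S ≈ splitSum (permSum F) (permSum G) S
  permSum-cutSum F G [] = ≈-refl
  permSum-cutSum F G (x ∷ S) = begin
    permSum (insSum x (cutSum F G)) S
      ≈⟨ permSum-cong (insSum-cutSum F G x) S ⟩
    permSum (λ y → cutSum (insSum x F) G y + cutSum F (insSum x G) y) S
      ≈⟨ permSum-+ _ _ S ⟩
    permSum (cutSum (insSum x F) G) S + permSum (cutSum F (insSum x G)) S
      ≈⟨ +-cong (permSum-cutSum _ G S) (permSum-cutSum F _ S) ⟩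
    _ ∎

  insSum-++ : (F : List A → K) (x a : A) (ys : List A) →
    insSum x F (ys ++ a ∷ []) ≈ insSum x (λ z → F (z ++ a ∷ [])) ys + F (ys ++ a ∷ x ∷ [])
  insSum-++ F x a [] = ≈-refl
  insSum-++ F x a (y ∷ ys) = ≈-trans (+-congˡ (insSum-++ _ x a ys)) (≈-sym (+-assoc _ _ _))

  -- The insertion places are visited in the opposite order: insertion at the front becomes
  -- insertion at the end, the term that `insSum-++` splits off.
  insSum-reverse : (F : List A → K) (x : A) (y : List A) →
    insSum x (λ z → F (reverse z)) y ≈ insSum x F (reverse y)
  insSum-reverse F x [] = ≈-refl
  insSum-reverse F x (y ∷ ys) = begin
    F (reverse (x ∷ y ∷ ys)) + insSum x (λ z → F (reverse (y ∷ z))) ys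
      ≈⟨ +-cong (reflexive (cong F (reverse-∷∷ ys)))
                (insSum-cong (λ z → reflexive (cong F (unfold-reverse y z))) ys) ⟩
    F (reverse ys ++ y ∷ x ∷ []) + insSum x (λ z → F (reverse z ++ y ∷ [])) ys
      ≈⟨ +-congˡ (insSum-reverse (λ z → F (z ++ y ∷ [])) x ys) ⟩
    F (reverse ys ++ y ∷ x ∷ []) + insSum x (λ z → F (z ++ y ∷ [])) (reverse ys)
      ≈⟨ +-comm _ _ ⟩
    insSum x (λ z → F (z ++ y ∷ [])) (reverse ys) + F (reverse ys ++ y ∷ x ∷ [])
      ≈⟨ insSum-++ F x y (reverse ys) ⟨
    insSum x F (reverse ys ++ y ∷ [])
      ≡⟨ cong (insSum x F) (unfold-reverse y ys) ⟨
    insSum x F (reverse (y ∷ ys)) ∎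
    where
    reverse-∷∷ : ∀ ys → reverse (x ∷ y ∷ ys) ≡ reverse ys ++ y ∷ x ∷ []
    reverse-∷∷ ys = trans (unfold-reverse x (y ∷ ys))
      (trans (cong (_++ x ∷ []) (unfold-reverse y ys)) (++-assoc (reverse ys) _ _))

  permSum-reverse : (F : List A → K) (S : List A) → permSum (λ z → F (reverse z)) S ≈ permSum F S
  permSum-reverse F [] = ≈-refl
  permSum-reverse F (x ∷ S) =
    ≈-trans (permSum-cong (insSum-reverse F x) S) (permSum-reverse (insSum x F) S)

  pathFrom : (A → A → K) → A → List A → K
  pathFrom M a [] = 1#
  pathFrom M a (y ∷ c) = M a y * pathFrom M y c

  path : (A → A → K) → List A → K
  path M [] = 1#
  path M (a ∷ c) = pathFrom M a c

  walk : (A → A → K) → A → List A → A → K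
  walk M a [] z = M a z
  walk M a (y ∷ c) z = M a y * walk M y c z

  walk-++ : (M : A → A → K) (a : A) (c : List A) (y z : A) →
    walk M a (c ++ y ∷ []) z ≈ walk M a c y * M y z
  walk-++ M a [] y z = ≈-refl
  walk-++ M a (x ∷ c) y z = ≈-trans (*-congˡ (walk-++ M x c y z)) (≈-sym (*-assoc _ _ _))

  walk-reverse : (M : A → A → K) (a : A) (c : List A) (z : A) →
    walk M a (reverse c) z ≈ walk (λ x y → M y x) z c a
  walk-reverse M a [] z = ≈-refl
  walk-reverse M a (y ∷ c) z = begin
    walk M a (reverse (y ∷ c)) z       ≡⟨ cong (λ c′ → walk M a c′ z) (unfold-reverse y c) ⟩
    walk M a (reverse c ++ y ∷ []) z   ≈⟨ walk-++ M a (reverse c) y z ⟩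
    walk M a (reverse c) y * M y z     ≈⟨ *-congʳ (walk-reverse M a c y) ⟩
    walk (λ x y → M y x) y c a * M y z ≈⟨ *-comm _ _ ⟩
    walk (λ x y → M y x) z (y ∷ c) a   ∎

  -- Expansion of path weights into broken cycles through a vertex

  module CyclicDecomposition {A : Set} (e b : A → A → K) (e≈1+b : ∀ x y → e x y ≈ 1# + b x y) (v : A) where

    -- The weight of the stretch from a break up to `v`. The value 0 at the empty list forces this
    -- stretch to be nonempty: in `openWalk` the step into `v` is already `b`, so no 1 can be chosen
    -- there.
    tailWalk : List A → K
    tailWalk [] = 0#
    tailWalk (a ∷ c) = walk b a c v

    -- The part of `walk e a c v` in which the step into `v` contributes `b` rather than 1.
    openWalk : A → List A → K
    openWalk a [] = b a v
    openWalk a (y ∷ c) = e a y * openWalk y c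

    openEnd : List A → K
    openEnd [] = 0#
    openEnd (a ∷ c) = openWalk a c

    walk≈pathFrom+openWalk : ∀ a c → walk e a c v ≈ pathFrom e a c + openWalk a c
    walk≈pathFrom+openWalk a [] = e≈1+b a v
    walk≈pathFrom+openWalk a (y ∷ c) = ≈-trans (*-congˡ (walk≈pathFrom+openWalk y c)) (distribˡ _ _ _)

    -- Expand each factor e = 1 + b and sort the terms by the last factor from which 1 is chosen.
    openWalk-expand : ∀ a c → openWalk a c ≈ walk b a c v + cutSum (pathFrom e a) tailWalk c
    openWalk-expand a [] = solve 1 (λ b → b := b :+ con 1 :* con 0) ≈-refl _
    openWalk-expand a (y ∷ c) = begin
      e a y * openWalk y c
        ≈⟨ *-congˡ (openWalk-expand y c) ⟩
      e a y * (walk b y c v + cutSum (pathFrom e y) tailWalk c)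
        ≈⟨ distribˡ _ _ _ ⟩
      e a y * walk b y c v + e a y * cutSum (pathFrom e y) tailWalk c
        ≈⟨ +-cong (*-congʳ (e≈1+b a y)) (≈-sym (cutSum-*ˡ _ _ _ c)) ⟩
      (1# + b a y) * walk b y c v + cutSum (λ z → e a y * pathFrom e y z) tailWalk c
        ≈⟨ solve 3 (λ b w s → (con 1 :+ b) :* w :+ s := b :* w :+ (con 1 :* w :+ s)) ≈-refl _ _ _ ⟩
      b a y * walk b y c v + (1# * walk b y c v + cutSum (λ z → e a y * pathFrom e y z) tailWalk c) ∎

    openEnd-expand : ∀ u → openEnd u ≈ cutSum (path e) tailWalk u
    openEnd-expand [] = ≈-sym (zeroʳ _)
    openEnd-expand (a ∷ c) = ≈-trans (openWalk-expand a c) (+-congʳ (≈-sym (*-identityˡ _)))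

    -- The factor just before the inserted `v` is 1 + `b`: its 1 severs the path there and gives the
    -- first sum, its `b` gives the second.
    insSum-pathFrom : ∀ a y → insSum v (pathFrom e a) y ≈
      cutSum (pathFrom e a) (pathFrom e v) y + cutSum (openWalk a) (pathFrom e v) y
    insSum-pathFrom a [] = ≈-trans (*-congʳ (e≈1+b a v)) (distribʳ _ _ _)
    insSum-pathFrom a (y ∷ c) = begin
      e a v * α′ + insSum v (λ z → e a y * pathFrom e y z) c
        ≈⟨ +-cong (*-congʳ (e≈1+b a v)) (≈-trans (insSum-*ˡ _ _ v c) (*-congˡ (insSum-pathFrom y c))) ⟩
      (1# + b a v) * α′ + e a y * (cutSum (pathFrom e y) α c + cutSum (openWalk y) α c)
        ≈⟨ +-congˡ (≈-trans (distribˡ _ _ _) (+-cong (≈-sym (cutSum-*ˡ _ _ _ c)) (≈-sym (cutSum-*ˡ _ _ _ c)))) ⟩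
      (1# + b a v) * α′ + (cutSum (λ z → e a y * pathFrom e y z) α c + cutSum (λ z → e a y * openWalk y z) α c)
        ≈⟨ solve 4 (λ b a s t → (con 1 :+ b) :* a :+ (s :+ t) := con 1 :* a :+ s :+ (b :* a :+ t)) ≈-refl _ _ _ _ ⟩
      1# * α′ + cutSum (λ z → e a y * pathFrom e y z) α c + (b a v * α′ + cutSum (λ z → e a y * openWalk y z) α c) ∎
      where
      α : List A → K
      α = pathFrom e v
      α′ : K
      α′ = α (y ∷ c)

    -- When `v` comes first, no factor precedes it. This case is the term of the first sum with
    -- empty left part, and `openEnd []` = 0 keeps it out of the second.
    insSum-path : ∀ y → insSum v (path e) y ≈
      cutSum (path e) (pathFrom e v) y + cutSum openEnd (pathFrom e v) y
    insSum-path [] = solve 0 (con 1 := con 1 :* con 1 :+ con 0 :* con 1) ≈-refl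
    insSum-path (y ∷ c) = ≈-trans (+-congˡ (insSum-pathFrom y c))
      (solve 3 (λ a s t → a :+ (s :+ t) := con 1 :* a :+ s :+ (con 0 :* a :+ t)) ≈-refl _ _ _)

    -- The κ of the overview in a form without subtraction: the closed walks from `v` with at least
    -- one 1 chosen, opened at the last one. In the first summand that 1 is the step back into `v`;
    -- in the second it lies where the two pieces meet.
    cycleSum : List A → K
    cycleSum C = permSum (pathFrom e v) C + splitSum (permSum (pathFrom e v)) (permSum tailWalk) C

    -- The choices missing from `cycleSum` are those that take `b` at every step; they are added on
    -- the left since K has no subtraction.
    cycleSum-closed : ∀ C → cycleSum C + permSum (λ c → walk b v c v) C ≈ permSum (λ c → walk e v c v) C
    cycleSum-closed C = ≈-sym (begin
      permSum (λ c → walk e v c v) C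
        ≈⟨ permSum-cong (λ c → ≈-trans (walk≈pathFrom+openWalk v c) (+-congˡ (openWalk-expand v c))) C ⟩
      permSum (λ c → pathFrom e v c + (walk b v c v + cutSum (pathFrom e v) tailWalk c)) C
        ≈⟨ ≈-trans (permSum-+ _ _ C) (+-congˡ (permSum-+ _ _ C)) ⟩
      permSum (pathFrom e v) C + (permSum (λ c → walk b v c v) C + permSum (cutSum (pathFrom e v) tailWalk) C)
        ≈⟨ +-congˡ (+-congˡ (permSum-cutSum _ _ C)) ⟩
      permSum (pathFrom e v) C + (permSum (λ c → walk b v c v) C + splitSum (permSum (pathFrom e v)) (permSum tailWalk) C)
        ≈⟨ solve 3 (λ a s t → a :+ (s :+ t) := a :+ t :+ s) ≈-refl _ _ _ ⟩
      _ ∎)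

    -- In a listing, go back from `v` to the nearest factor from which 1 is chosen, or to the front.
    -- The `b`-stretch found there and the part after `v` join to a broken cycle through `v`; what
    -- lies before the break is an arbitrary path on the other entries. Since the product `splitSum`
    -- is commutative and associative, the two pieces of the cycle can be brought together.
    permSum-path : ∀ S → permSum (path e) (v ∷ S) ≈ splitSum cycleSum (permSum (path e)) S
    permSum-path S = begin
      permSum (insSum v (path e)) S
        ≈⟨ ≈-trans (permSum-cong insSum-path S) (permSum-+ _ _ S) ⟩
      permSum (cutSum (path e) (pathFrom e v)) S + permSum (cutSum openEnd (pathFrom e v)) S
        ≈⟨ +-cong (permSum-cutSum _ _ S) (permSum-cutSum _ _ S) ⟩
      splitSum N α S + splitSum (permSum openEnd) α S
        ≈⟨ +-congˡ (splitSum-congˡ (λ C → ≈-trans (permSum-cong openEnd-expand C) (permSum-cutSum _ _ C)) S) ⟩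
      splitSum N α S + splitSum (splitSum N η) α S
        ≈⟨ +-cong (splitSum-comm N α S)
                  (≈-trans (splitSum-comm _ α S)
                         (≈-trans (splitSum-congʳ (splitSum-comm N η) S) (≈-sym (splitSum-assoc α η N S)))) ⟩
      splitSum α N S + splitSum (splitSum α η) N S
        ≈⟨ splitSum-+ˡ _ _ N S ⟨
      splitSum cycleSum N S ∎
      where
      N α η : List A → K
      N = permSum (path e)
      α = permSum (pathFrom e v)
      η = permSum tailWalk

-- Transport along semiring homomorphisms

module Homomorphism {c ℓ c′ ℓ′ : Level} (R : CommutativeSemiring c ℓ) (R′ : CommutativeSemiring c′ ℓ′) where
  private
    module R = CommutativeSemiring R
    module R′ = CommutativeSemiring R′
    module Σ = ShuffleAlgebra R
    module Σ′ = ShuffleAlgebra R′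

  module _ (h : R.Carrier → R′.Carrier)
           (h-+ : ∀ x y → h (x R.+ y) R′.≈ h x R′.+ h y)
           (h-* : ∀ x y → h (x R.* y) R′.≈ h x R′.* h y) where

    insSum-hom : (F : List A → R.Carrier) (x : A) (y : List A) →
      h (Σ.insSum x F y) R′.≈ Σ′.insSum x (λ z → h (F z)) y
    insSum-hom F x [] = R′.refl
    insSum-hom F x (y ∷ ys) = R′.trans (h-+ _ _) (R′.+-congˡ (insSum-hom _ x ys))

    permSum-hom : (F : List A → R.Carrier) (S : List A) →
      h (Σ.permSum F S) R′.≈ Σ′.permSum (λ z → h (F z)) S
    permSum-hom F [] = R′.refl
    permSum-hom F (x ∷ S) = R′.trans (permSum-hom _ S) (Σ′.permSum-cong (insSum-hom F x) S)

    splitSum-hom : (f g : List A → R.Carrier) (S : List A) →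
      h (Σ.splitSum f g S) R′.≈ Σ′.splitSum (λ z → h (f z)) (λ z → h (g z)) S
    splitSum-hom f g [] = h-* _ _
    splitSum-hom f g (x ∷ S) = R′.trans (h-+ _ _) (R′.+-cong (splitSum-hom _ g S) (splitSum-hom f _ S))

    module _ (h-1 : h R.1# R′.≈ R′.1#) {M : A → A → R.Carrier} {M′ : A → A → R′.Carrier}
             (h-M : ∀ x y → h (M x y) R′.≈ M′ x y) where

      pathFrom-hom : ∀ a c → h (Σ.pathFrom M a c) R′.≈ Σ′.pathFrom M′ a c
      pathFrom-hom a [] = h-1
      pathFrom-hom a (y ∷ c) = R′.trans (h-* _ _) (R′.*-cong (h-M a y) (pathFrom-hom y c))

      path-hom : ∀ w → h (Σ.path M w) R′.≈ Σ′.path M′ w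
      path-hom [] = h-1
      path-hom (a ∷ c) = pathFrom-hom a c

-- Tournaments

Unique-resp-↭ : {xs ys : List A} → xs ↭ ys → Unique xs → Unique ys
Unique-resp-↭ {A} xs↭ys = ↭ₛ.Unique-resp-↭ (≡.setoid A) (↭⇒↭ₛ xs↭ys)

All-Interleaving : {P : A → Set} {C B S : List A} → Interleaving C B S → All P S → All P C
All-Interleaving [] [] = []
All-Interleaving (consˡ i) (p ∷ ps) = p ∷ All-Interleaving i ps
All-Interleaving (consʳ i) (p ∷ ps) = All-Interleaving i ps

AllPairs-Interleaving : {P : A → A → Set} {C B S : List A} → Interleaving C B S → AllPairs P S → AllPairs P C
AllPairs-Interleaving [] [] = []
AllPairs-Interleaving (consˡ i) (p ∷ ps) = All-Interleaving i p ∷ AllPairs-Interleaving i ps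
AllPairs-Interleaving (consʳ i) (p ∷ ps) = AllPairs-Interleaving i ps

isWalk : Digraph n → Fin n → List (Fin n) → Fin n → Bool
isWalk D a [] z = D a z
isWalk D a (y ∷ c) z = D a y ∧ isWalk D y c z

-- The share of one cycle in the coefficient on the right-hand side: a fixed point gives 1, an odd
-- nontrivial D-cycle gives one factor of `2 ^ ψ`, and 0 removes the permutations that the sum
-- leaves out.
cycleWeight : Digraph n → List (Fin n) → ℕ
cycleWeight D (v ∷ c@(_ ∷ _)) = if isOdd (length (v ∷ c)) ∧ isWalk D v c v then 2 else 0
cycleWeight D _ = 1

module NonArc {c ℓ : Level} (R : CommutativeSemiring c ℓ) where
  open CommutativeSemiring R using (Carrier; 0#; 1#)

  -- With this matrix `path` is the indicator of a listing without descents, and `permSum` of it is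
  -- the function N of the overview.
  nonArc : Digraph n → Fin n → Fin n → Carrier
  nonArc D a z = if D a z then 0# else 1#

ℕ-semiring : CommutativeSemiring 0ℓ 0ℓ
ℕ-semiring = ℕₚ.+-*-commutativeSemiring

ℤ-semiring : CommutativeSemiring 0ℓ 0ℓ
ℤ-semiring = ℤₚ.+-*-commutativeSemiring

module Tournament {n : ℕ} (D : Digraph n) (tournament : IsTournament D) where
  open ShuffleAlgebra ℤ-semiring
  open NonArc ℤ-semiring

  e b : Fin n → Fin n → ℤ
  e = nonArc D
  b a z = if D a z then ℤ.- + 1 else + 0

  e≡1+b : ∀ a z → e a z ≡ + 1 ℤ.+ b a z
  e≡1+b a z with D a z
  ... | true = refl
  ... | false = refl

  walk-b : ∀ a c z → walk b a c z ≡
    (if isWalk D a c z then (if isOdd (length c) then + 1 else ℤ.- + 1) else + 0)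
  walk-b a [] z = refl
  walk-b a (y ∷ c) z with D a y
  ... | false = ℤₚ.*-zeroˡ (walk b y c z)
  ... | true rewrite walk-b y c z with isWalk D y c z | isOdd (length c)
  ...   | false | _     = refl
  ...   | true  | true  = refl
  ...   | true  | false = refl

  -- Here the tournament axiom on pairs of distinct vertices enters: a non-arc read backwards is an
  -- arc.
  e-flip : ∀ {a z} → a ≢ z → e z a ≡ (if D a z then + 1 else + 0)
  e-flip {a} {z} a≢z rewrite proj₂ tournament a z a≢z with D z a
  ... | true = refl
  ... | false = refl

  walk-flip : ∀ a c z → Unique (a ∷ c) → All (z ≢_) (a ∷ c) →
    walk (λ x y → e y x) a c z ≡ (if isWalk D a c z then + 1 else + 0)
  walk-flip a [] z _ (z≢a ∷ []) = e-flip (λ a≡z → z≢a (sym a≡z))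
  walk-flip a (y ∷ c) z ((a≢y ∷ _) ∷ uniq) (_ ∷ z≢)
    rewrite e-flip a≢y | walk-flip y c z uniq z≢ with D a y | isWalk D y c z
  ... | true | true = refl
  ... | true | false = refl
  ... | false | _ = refl

  -- The non-arc cycles become, read backwards, the arc cycles; the signs then cancel
  -- the latter in even length and double them in odd length.
  cycleWeight-walk : ∀ v c → Unique (v ∷ c) →
    + cycleWeight D (v ∷ c) ℤ.+ walk b v c v ≡ walk e v (reverse c) v
  cycleWeight-walk v [] _ rewrite proj₁ tournament v = refl
  cycleWeight-walk v (y ∷ c) uniq@((v≢y ∷ v≢) ∷ uniq′)
    rewrite walk-reverse e v (y ∷ c) v | walk-b v (y ∷ c) v
          | e-flip v≢y | walk-flip y c v uniq′ (v≢y ∷ v≢)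
    with D v y | isWalk D y c v | isOdd (length c)
  ... | true | true | true = refl
  ... | true | true | false = refl
  ... | true | false | true = refl
  ... | true | false | false = refl
  ... | false | _ | true = refl
  ... | false | _ | false = refl

  -- After the all-`b` cycles are added to both sides, `cycleWeight-walk` matches each order of the
  -- cycle with its reversal, and a sum over all orders does not see the reversal. Cancelling the
  -- added sum is what requires ℤ.
  cycleSum-tournament : ∀ v C → Unique (v ∷ C) →
    permSum (λ c → + cycleWeight D (v ∷ c)) C ≡ CyclicDecomposition.cycleSum e b e≡1+b v C
  cycleSum-tournament v C uniq = ∙-cancelʳ (permSum (λ c → walk b v c v) C) _ _ (begin
    permSum (λ c → + cycleWeight D (v ∷ c)) C ℤ.+ permSum (λ c → walk b v c v) C
      ≡⟨ permSum-+ _ _ C ⟨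
    permSum (λ c → + cycleWeight D (v ∷ c) ℤ.+ walk b v c v) C
      ≡⟨ permSum-cong-↭ C (λ c c↭C → cycleWeight-walk v c (Unique-resp-↭ (prep v (↭-sym c↭C)) uniq)) ⟩
    permSum (λ c → walk e v (reverse c) v) C
      ≡⟨ permSum-reverse _ C ⟩
    permSum (λ c → walk e v c v) C
      ≡⟨ CyclicDecomposition.cycleSum-closed e b e≡1+b v C ⟨
    CyclicDecomposition.cycleSum e b e≡1+b v C ℤ.+ permSum (λ c → walk b v c v) C ∎)
    where
    open ≡.≡-Reasoning
    open import Algebra.Properties.AbelianGroup ℤₚ.+-0-abelianGroup using (∙-cancelʳ)

  permSum-nonArc-ℤ : ∀ v S → Unique (v ∷ S) → permSum (path e) (v ∷ S) ≡
    splitSum (permSum (λ c → + cycleWeight D (v ∷ c))) (permSum (path e)) S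
  permSum-nonArc-ℤ v S uniq = trans (CyclicDecomposition.permSum-path e b e≡1+b v S)
    (splitSum-cong S (λ C B i → cong (ℤ._* permSum (path e) B)
      (sym (cycleSum-tournament v C (AllPairs-Interleaving (consˡ i) uniq)))))

  private
    module Sℕ = ShuffleAlgebra ℕ-semiring
    module ℕ→ℤ = Homomorphism ℕ-semiring ℤ-semiring

  -- The signs have disappeared from the recursion, so it can be pulled back along the injection of
  -- ℕ into ℤ. From ℕ, unlike from ℤ, there is a homomorphism to every commutative semiring.
  permSum-nonArc-ℕ : ∀ v S → Unique (v ∷ S) → Sℕ.permSum (Sℕ.path (NonArc.nonArc ℕ-semiring D)) (v ∷ S) ≡
    Sℕ.splitSum (Sℕ.permSum (λ c → cycleWeight D (v ∷ c))) (Sℕ.permSum (Sℕ.path (NonArc.nonArc ℕ-semiring D))) S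
  permSum-nonArc-ℕ v S uniq = ℤₚ.+-injective (begin
    + Sℕ.permSum pathℕ (v ∷ S)
      ≡⟨ N-hom (v ∷ S) ⟩
    permSum (path e) (v ∷ S)
      ≡⟨ permSum-nonArc-ℤ v S uniq ⟩
    splitSum (permSum (λ c → + cycleWeight D (v ∷ c))) (permSum (path e)) S
      ≡⟨ splitSum-cong S (λ C B _ → cong₂ ℤ._*_ (ℕ→ℤ.permSum-hom +_ ℤₚ.pos-+ ℤₚ.pos-* _ C) (N-hom B)) ⟨
    splitSum (λ C → + Sℕ.permSum (λ c → cycleWeight D (v ∷ c)) C) (λ B → + Sℕ.permSum pathℕ B) S
      ≡⟨ ℕ→ℤ.splitSum-hom +_ ℤₚ.pos-+ ℤₚ.pos-* _ _ S ⟨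
    + Sℕ.splitSum (Sℕ.permSum (λ c → cycleWeight D (v ∷ c))) (Sℕ.permSum pathℕ) S ∎)
    where
    open ≡.≡-Reasoning
    pathℕ : List (Fin n) → ℕ
    pathℕ = Sℕ.path (NonArc.nonArc ℕ-semiring D)
    nonArc-hom : ∀ a z → + NonArc.nonArc ℕ-semiring D a z ≡ e a z
    nonArc-hom a z with D a z
    ... | true = refl
    ... | false = refl
    N-hom : ∀ B → + Sℕ.permSum pathℕ B ≡ permSum (path e) B
    N-hom B = trans (ℕ→ℤ.permSum-hom +_ ℤₚ.pos-+ ℤₚ.pos-* pathℕ B)
      (permSum-cong (ℕ→ℤ.path-hom +_ ℤₚ.pos-+ ℤₚ.pos-* refl nonArc-hom) B)

-- The recursion for U_D

Interleaving-length : {C B S : List A} → Interleaving C B S → length S ≡ length C ℕ.+ length B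
Interleaving-length {C = C} i = trans (↭-length (toPermutation i)) (length-++ C)

-- Finite sums and natural multiples in a semiring

module FiniteSums {c ℓ : Level} (R : CommutativeSemiring c ℓ) where
  open CommutativeSemiring R hiding (zero; refl; sym; trans) renaming (Carrier to K)
  open CommutativeSemiring R using () renaming (refl to ≈-refl; sym to ≈-sym; trans to ≈-trans)
  open Eval R
  open import Algebra.Solver.Ring.NaturalCoefficients.Default R using (solve; _:+_; _:*_; _:=_; con)

  ∑ : {B : Set} → (B → K) → List B → K
  ∑ F xs = sumR (map F xs)

  ∑-cong : {B : Set} {F G : B → K} → (∀ y → F y ≈ G y) → ∀ xs → ∑ F xs ≈ ∑ G xs
  ∑-cong h [] = ≈-refl
  ∑-cong h (y ∷ xs) = +-cong (h y) (∑-cong h xs)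

  ∑-*ˡ : {B : Set} (k : K) (F : B → K) (xs : List B) → ∑ (λ y → k * F y) xs ≈ k * ∑ F xs
  ∑-*ˡ k F [] = ≈-sym (zeroʳ k)
  ∑-*ˡ k F (y ∷ xs) = ≈-trans (+-congˡ (∑-*ˡ k F xs)) (≈-sym (distribˡ k _ _))

  ∑-++ : {B : Set} (F : B → K) (xs ys : List B) → ∑ F (xs ++ ys) ≈ ∑ F xs + ∑ F ys
  ∑-++ F [] ys = ≈-sym (+-identityˡ _)
  ∑-++ F (y ∷ xs) ys = ≈-trans (+-congˡ (∑-++ F xs ys)) (≈-sym (+-assoc _ _ _))

  ∑-concatMap : {B C : Set} (F : C → K) (g : B → List C) (xs : List B) →
    ∑ F (concatMap g xs) ≈ ∑ (λ y → ∑ F (g y)) xs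
  ∑-concatMap F g [] = ≈-refl
  ∑-concatMap F g (y ∷ xs) = ≈-trans (∑-++ F (g y) _) (+-congˡ (∑-concatMap F g xs))

  ∑-map : {B C : Set} (F : C → K) (g : B → C) (xs : List B) → ∑ F (map g xs) ≡ ∑ (λ y → F (g y)) xs
  ∑-map F g xs = cong sumR (sym (map-∘ xs))

  ∑-filterᵇ : {B : Set} (F : B → K) (q : B → Bool) (xs : List B) →
    ∑ F (filterᵇ q xs) ≈ ∑ (λ y → if q y then F y else 0#) xs
  ∑-filterᵇ F q [] = ≈-refl
  ∑-filterᵇ F q (y ∷ xs) with q y
  ... | true = +-congˡ (∑-filterᵇ F q xs)
  ... | false = ≈-trans (∑-filterᵇ F q xs) (≈-sym (+-identityˡ _))

  ∑-↭ : {B : Set} (F : B → K) {xs ys : List B} → xs ↭ ys → ∑ F xs ≈ ∑ F ys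
  ∑-↭ F ↭.refl = ≈-refl
  ∑-↭ F (prep x p) = +-congˡ (∑-↭ F p)
  ∑-↭ F (↭.swap x y p) = ≈-trans (+-congˡ (+-congˡ (∑-↭ F p)))
    (solve 3 (λ a b c → a :+ (b :+ c) := b :+ (a :+ c)) ≈-refl _ _ _)
  ∑-↭ F (↭.trans p q) = ≈-trans (∑-↭ F p) (∑-↭ F q)

  ∑-allFin-suc : ∀ {m} (F : Fin (suc m) → K) → ∑ F (allFin (suc m)) ≡ F zero + ∑ (λ i → F (suc i)) (allFin m)
  ∑-allFin-suc F = cong (λ ks → F zero + sumR ks)
    (trans (map-tabulate suc F) (sym (map-tabulate (λ i → i) (λ i → F (suc i)))))

  natR-1 : natR 1 ≈ 1#
  natR-1 = +-identityʳ 1#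

  natR-+ : ∀ a b → natR (a ℕ.+ b) ≈ natR a + natR b
  natR-+ zero b = ≈-sym (+-identityˡ _)
  natR-+ (suc a) b = ≈-trans (+-congˡ (natR-+ a b)) (≈-sym (+-assoc _ _ _))

  natR-* : ∀ a b → natR (a ℕ.* b) ≈ natR a * natR b
  natR-* zero b = ≈-sym (zeroˡ _)
  natR-* (suc a) b = ≈-trans (natR-+ b (a ℕ.* b)) (≈-trans (+-congˡ (natR-* a b))
    (solve 2 (λ a b → b :+ a :* b := (con 1 :+ a) :* b) ≈-refl _ _))

  powR-+ : ∀ x a b → powR x (a ℕ.+ b) ≈ powR x a * powR x b
  powR-+ x zero b = ≈-sym (*-identityˡ _)
  powR-+ x (suc a) b = ≈-trans (*-congˡ (powR-+ x a b)) (≈-sym (*-assoc _ _ _))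

-- Fundamental quasisymmetric functions as sums over block decompositions

module Colourings {c ℓ : Level} (R : CommutativeSemiring c ℓ) {n : ℕ} (D : Digraph n) where
  open CommutativeSemiring R hiding (zero; refl; sym; trans) renaming (Carrier to K)
  open CommutativeSemiring R using () renaming (refl to ≈-refl; sym to ≈-sym; trans to ≈-trans)
  open Eval R
  open ShuffleAlgebra R
  open NonArc R
  open FiniteSums R
  open import Algebra.Solver.Ring.NaturalCoefficients.Default R using (solve; _:+_; _:*_; _:=_; con)
  open import Relation.Binary.Reasoning.Setoid setoid

  block : K → List (Fin n) → K
  block t u = path (nonArc D) u * powR t (length u)

  -- The fundamental quasisymmetric function of Des(w, D): cut w into one (possibly empty)
  -- block per variable, no block containing a descent.
  blockSum : ∀ {m} → (Fin m → K) → List (Fin n) → K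
  blockSum {zero} x [] = 1#
  blockSum {zero} x (_ ∷ _) = 0#
  blockSum {suc m} x = cutSum (block (x zero)) (blockSum (λ i → x (suc i)))

  blockSum-[] : ∀ {m} (x : Fin m → K) → blockSum x [] ≈ 1#
  blockSum-[] {zero} x = ≈-refl
  blockSum-[] {suc m} x = ≈-trans (*-cong (*-identityˡ 1#) (blockSum-[] (λ i → x (suc i)))) (*-identityˡ 1#)

  mayFollow : ∀ {m} → Bool → Fin m → Fin m → Bool
  mayFollow d i j = if d then toℕ i <ᵇ toℕ j else toℕ i ≤ᵇ toℕ j

  mayFollow-suc : ∀ {m} d (i j : Fin m) → mayFollow d (suc i) (suc j) ≡ mayFollow d i j
  mayFollow-suc true i j = refl
  mayFollow-suc false zero j = refl
  mayFollow-suc false (suc i) j = refl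

  mayFollow-suc-zero : ∀ {m} d (i : Fin m) → mayFollow d (suc i) zero ≡ false
  mayFollow-suc-zero true i = refl
  mayFollow-suc-zero false i = refl

  mayFollow-zero-suc : ∀ {m} d (j : Fin m) → mayFollow {suc m} d zero (suc j) ≡ true
  mayFollow-zero-suc true j = refl
  mayFollow-zero-suc false j = refl

  mayFollow-zero-zero : ∀ {m} d → mayFollow {suc m} d zero zero ≡ not d
  mayFollow-zero-zero true = refl
  mayFollow-zero-zero false = refl

  -- The admissible colourings of `a ∷ r` by variables in which `a` receives `i`. This mediates
  -- between `L`, a sum over index tuples that grows with the list, and `blockSum`, which recurses
  -- on the number of variables.
  colourFrom : ∀ {m} → (Fin m → K) → Fin n → List (Fin n) → Fin m → K
  colourFrom x a [] i = x i
  colourFrom {m} x a (z ∷ r) i =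
    x i * ∑ (λ j → if mayFollow (D a z) i j then colourFrom x z r j else 0#) (allFin m)

  -- Indices never decrease along a listing, so after a first index `suc i` the variable `x zero`
  -- cannot occur.
  colourFrom-suc : ∀ {m} (x : Fin (suc m) → K) a r i →
    colourFrom x a r (suc i) ≈ colourFrom (λ j → x (suc j)) a r i
  colourFrom-suc x a [] i = ≈-refl
  colourFrom-suc {m} x a (z ∷ r) i = *-congˡ (begin
    ∑ (λ j → if mayFollow (D a z) (suc i) j then colourFrom x z r j else 0#) (allFin (suc m))
      ≡⟨ ∑-allFin-suc (λ j → if mayFollow (D a z) (suc i) j then colourFrom x z r j else 0#) ⟩
    (if mayFollow (D a z) (suc i) zero then colourFrom x z r zero else 0#)
      + ∑ (λ j → if mayFollow (D a z) (suc i) (suc j) then colourFrom x z r (suc j) else 0#) (allFin m)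
      ≈⟨ +-cong (reflexive (cong (λ q → if q then _ else 0#) (mayFollow-suc-zero (D a z) i)))
                (∑-cong step (allFin m)) ⟩
    0# + ∑ (λ j → if mayFollow (D a z) i j then colourFrom (λ j → x (suc j)) z r j else 0#) (allFin m)
      ≈⟨ +-identityˡ _ ⟩
    _ ∎)
    where
    step : ∀ j → (if mayFollow (D a z) (suc i) (suc j) then colourFrom x z r (suc j) else 0#) ≈
                 (if mayFollow (D a z) i j then colourFrom (λ j → x (suc j)) z r j else 0#)
    step j rewrite mayFollow-suc (D a z) i j with mayFollow (D a z) i j
    ... | true = colourFrom-suc x z r j
    ... | false = ≈-refl

  module _ {m} (x : Fin (suc m) → K) where
    private
      x′ : Fin m → K
      x′ i = x (suc i)

    firstBlock : Fin n → List (Fin n) → K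
    firstBlock a = cutSum (λ u → block (x zero) (a ∷ u)) (blockSum x′)

    -- Either `z` joins the block of `a`, which costs the non-arc factor, or the block ends and `z`
    -- is left to the remaining variables.
    firstBlock-∷ : ∀ a z r → firstBlock a (z ∷ r) ≈
      x zero * (nonArc D a z * firstBlock z r + blockSum x′ (z ∷ r))
    firstBlock-∷ a z r = begin
      1# * (x zero * 1#) * blockSum x′ (z ∷ r) + cutSum (λ u → block (x zero) (a ∷ z ∷ u)) (blockSum x′) r
        ≈⟨ +-congˡ (≈-trans (cutSum-congˡ (λ u → solve 4 (λ e p x q → e :* p :* (x :* q) := e :* x :* (p :* q)) ≈-refl _ _ _ _) r)
                          (cutSum-*ˡ _ _ (nonArc D a z * x zero) r)) ⟩
      1# * (x zero * 1#) * blockSum x′ (z ∷ r) + nonArc D a z * x zero * firstBlock z r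
        ≈⟨ solve 4 (λ x b e f → con 1 :* (x :* con 1) :* b :+ e :* x :* f := x :* (e :* f :+ b)) ≈-refl _ _ _ _ ⟩
      _ ∎

  -- These statements need each other: `colourFrom-zero` recurses on a shorter list, `∑-colourFrom`
  -- on fewer variables.
  colourFrom-zero : ∀ {m} (x : Fin (suc m) → K) a r → colourFrom x a r zero ≈ firstBlock x a r
  ∑-colourFrom : ∀ {m} (x : Fin m → K) a r → ∑ (colourFrom x a r) (allFin m) ≈ blockSum x (a ∷ r)
  ∑-colourFrom-suc : ∀ {m} (x : Fin (suc m) → K) a r →
    ∑ (λ i → colourFrom x a r (suc i)) (allFin m) ≈ blockSum (λ i → x (suc i)) (a ∷ r)

  ∑-colourFrom-suc {m} x a r = ≈-trans (∑-cong (colourFrom-suc x a r) (allFin m)) (∑-colourFrom (λ i → x (suc i)) a r)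

  ∑-colourFrom {zero} x a r = ≈-refl
  ∑-colourFrom {suc m} x a r = begin
    ∑ (colourFrom x a r) (allFin (suc m))
      ≡⟨ ∑-allFin-suc (colourFrom x a r) ⟩
    colourFrom x a r zero + ∑ (λ i → colourFrom x a r (suc i)) (allFin m)
      ≈⟨ +-cong (colourFrom-zero x a r) (∑-colourFrom-suc x a r) ⟩
    -- The second summand is the case of an empty first block, whose weight is 1 * 1.
    firstBlock x a r + blockSum (λ i → x (suc i)) (a ∷ r)
      ≈⟨ solve 2 (λ f b → f :+ b := con 1 :* con 1 :* b :+ f) ≈-refl _ _ ⟩
    _ ∎

  colourFrom-zero x a [] = ≈-sym (≈-trans (*-cong (≈-trans (*-identityˡ _) (*-identityʳ _)) (blockSum-[] (λ i → x (suc i)))) (*-identityʳ _))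
  colourFrom-zero {m} x a (z ∷ r) = begin
    x zero * ∑ (λ j → if mayFollow (D a z) zero j then colourFrom x z r j else 0#) (allFin (suc m))
      ≡⟨ cong (x zero *_) (∑-allFin-suc (λ j → if mayFollow (D a z) zero j then colourFrom x z r j else 0#)) ⟩
    x zero * ((if mayFollow {suc m} (D a z) zero zero then colourFrom x z r zero else 0#)
      + ∑ (λ j → if mayFollow (D a z) zero (suc j) then colourFrom x z r (suc j) else 0#) (allFin m))
      ≈⟨ *-congˡ (+-cong same (≈-trans (∑-cong (λ j → reflexive (cong (λ q → if q then _ else 0#)
                                        (mayFollow-zero-suc (D a z) j))) (allFin m))
                                      (∑-colourFrom-suc x z r))) ⟩
    x zero * (nonArc D a z * firstBlock x z r + blockSum (λ i → x (suc i)) (z ∷ r))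
      ≈⟨ firstBlock-∷ x a z r ⟨
    firstBlock x a (z ∷ r) ∎
    where
    same : (if mayFollow {suc m} (D a z) zero zero then colourFrom x z r zero else 0#) ≈
           nonArc D a z * firstBlock x z r
    same rewrite mayFollow-zero-zero {m} (D a z) with D a z
    ... | true = ≈-sym (zeroˡ _)
    ... | false = ≈-trans (colourFrom-zero x z r) (≈-sym (*-identityˡ _))

  -- Positions are 1-based, and the shifted descent set of `a ∷ z ∷ r` may differ from the descent
  -- set of `z ∷ r` at position 0, so agreement is asked at positive positions.
  admissible-cong : ∀ {m} {I J : ℕ → Bool} → (∀ q → I (suc q) ≡ J (suc q)) →
    (s : List (Fin m)) → admissible I s ≡ admissible J s
  admissible-cong h [] = refl
  admissible-cong h (i ∷ []) = refl
  admissible-cong h (i ∷ j ∷ s) = cong₂ (λ d q → mayFollow d i j ∧ q) (h 0)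
    (admissible-cong (λ q → h (suc q)) (j ∷ s))

  monomial : ∀ {m} → (Fin m → K) → List (Fin n) → List (Fin m) → K
  monomial x w s = if admissible (des D w) s then prodR (map x s) else 0#

  monomial-∷ : ∀ {m} (x : Fin m → K) a z r i j s → monomial x (a ∷ z ∷ r) (i ∷ j ∷ s) ≈
    x i * (if mayFollow (D a z) i j then monomial x (z ∷ r) (j ∷ s) else 0#)
  monomial-∷ x a z r i j s
    rewrite admissible-cong {I = λ q → des D (a ∷ z ∷ r) (suc q)} {J = des D (z ∷ r)} (λ _ → refl) (j ∷ s)
    with mayFollow (D a z) i j
  ... | false = ≈-sym (zeroʳ _)
  ... | true with admissible (des D (z ∷ r)) (j ∷ s)
  ...   | false = ≈-sym (zeroʳ _)
  ...   | true = ≈-refl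

  ∑-monomial : ∀ {m k} (x : Fin m → K) a (r : Vec (Fin n) k) i →
    ∑ (λ s → monomial x (a ∷ toList r) (i ∷ toList s)) (vecs (allFin m) k) ≈ colourFrom x a (toList r) i
  ∑-monomial x a []ᵛ i = ≈-trans (+-identityʳ _) (*-identityʳ _)
  ∑-monomial {m} {suc k} x a (z ∷ᵛ r) i = begin
    ∑ (λ s → monomial x (a ∷ z ∷ toList r) (i ∷ toList s)) (vecs (allFin m) (suc k))
      ≈⟨ ∑-concatMap _ (λ j → map (j ∷ᵛ_) (vecs (allFin m) k)) (allFin m) ⟩
    ∑ (λ j → ∑ (λ s → monomial x (a ∷ z ∷ toList r) (i ∷ toList s)) (map (j ∷ᵛ_) (vecs (allFin m) k))) (allFin m)
      ≈⟨ ∑-cong (λ j → ≈-trans (reflexive (∑-map _ (j ∷ᵛ_) (vecs (allFin m) k))) (inner j)) (allFin m) ⟩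
    ∑ (λ j → x i * (if mayFollow (D a z) i j then colourFrom x z (toList r) j else 0#)) (allFin m)
      ≈⟨ ∑-*ˡ _ _ (allFin m) ⟩
    _ ∎
    where
    inner : ∀ j → ∑ (λ s → monomial x (a ∷ z ∷ toList r) (i ∷ j ∷ toList s)) (vecs (allFin m) k) ≈
      x i * (if mayFollow (D a z) i j then colourFrom x z (toList r) j else 0#)
    inner j = ≈-trans (∑-cong (λ s → monomial-∷ x a z (toList r) i j (toList s)) (vecs (allFin m) k))
      (≈-trans (∑-*ˡ _ _ (vecs (allFin m) k)) (*-congˡ inner′))
      where
      inner′ : ∑ (λ s → if mayFollow (D a z) i j then monomial x (z ∷ toList r) (j ∷ toList s) else 0#)
                 (vecs (allFin m) k) ≈
               (if mayFollow (D a z) i j then colourFrom x z (toList r) j else 0#)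
      inner′ with mayFollow (D a z) i j
      ... | true = ∑-monomial x z r j
      ... | false = ≈-trans (∑-cong (λ _ → ≈-sym (zeroˡ 0#)) (vecs (allFin m) k))
                          (≈-trans (∑-*ˡ 0# (λ _ → 0#) (vecs (allFin m) k)) (zeroˡ _))

  L-blockSum : ∀ {m k} (x : Fin m → K) (w : Vec (Fin n) k) → L x (des D (toList w)) k ≈ blockSum x (toList w)
  L-blockSum x []ᵛ = ≈-trans (+-identityʳ _) (≈-sym (blockSum-[] x))
  L-blockSum {m} {suc k} x (a ∷ᵛ r) = begin
    ∑ (λ s → monomial x (a ∷ toList r) (toList s)) (vecs (allFin m) (suc k))
      ≈⟨ ∑-concatMap _ (λ i → map (i ∷ᵛ_) (vecs (allFin m) k)) (allFin m) ⟩
    ∑ (λ i → ∑ (λ s → monomial x (a ∷ toList r) (toList s)) (map (i ∷ᵛ_) (vecs (allFin m) k))) (allFin m)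
      ≈⟨ ∑-cong (λ i → ≈-trans (reflexive (∑-map _ (i ∷ᵛ_) (vecs (allFin m) k))) (∑-monomial x a r i)) (allFin m) ⟩
    ∑ (colourFrom x a (toList r)) (allFin m)
      ≈⟨ ∑-colourFrom x a (toList r) ⟩
    _ ∎

  module Recursion (tournament : IsTournament D) where

    N : List (Fin n) → K
    N = permSum (path (nonArc D))

    cycleCount : Fin n → List (Fin n) → K
    cycleCount v = permSum (λ c → natR (cycleWeight D (v ∷ c)))

    private
      module ℕ→R = Homomorphism ℕ-semiring R
      module Sℕ = ShuffleAlgebra ℕ-semiring

      Nℕ : List (Fin n) → ℕ
      Nℕ = Sℕ.permSum (Sℕ.path (NonArc.nonArc ℕ-semiring D))

      nonArc-hom : ∀ a z → natR (NonArc.nonArc ℕ-semiring D a z) ≈ nonArc D a z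
      nonArc-hom a z with D a z
      ... | true = ≈-refl
      ... | false = natR-1

      N-hom : ∀ S → natR (Nℕ S) ≈ N S
      N-hom S = ≈-trans (ℕ→R.permSum-hom natR natR-+ natR-* _ S)
        (permSum-cong (ℕ→R.path-hom natR natR-+ natR-* natR-1 nonArc-hom) S)

    N-∷ : ∀ v S → Unique (v ∷ S) → N (v ∷ S) ≈ splitSum (cycleCount v) N S
    N-∷ v S uniq = begin
      N (v ∷ S)
        ≈⟨ N-hom (v ∷ S) ⟨
      natR (Nℕ (v ∷ S))
        ≡⟨ cong natR (Tournament.permSum-nonArc-ℕ D tournament v S uniq) ⟩
      natR (Sℕ.splitSum (Sℕ.permSum (λ c → cycleWeight D (v ∷ c))) Nℕ S)
        ≈⟨ ℕ→R.splitSum-hom natR natR-+ natR-* _ _ S ⟩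
      splitSum (λ C → natR (Sℕ.permSum (λ c → cycleWeight D (v ∷ c)) C)) (λ B → natR (Nℕ B)) S
        ≈⟨ splitSum-cong S (λ C B _ → *-cong (ℕ→R.permSum-hom natR natR-+ natR-* _ C) (N-hom B)) ⟩
      splitSum (cycleCount v) N S ∎

    blockN : K → List (Fin n) → K
    blockN t S = N S * powR t (length S)

    -- Powers of `t` are multiplicative over the split, since 1 + |S| = (1 + |C|) + |B|; the cycle
    -- of `v` takes the exponent 1 + |C|.
    blockN-∷ : ∀ t v S → Unique (v ∷ S) →
      blockN t (v ∷ S) ≈ splitSum (λ C → cycleCount v C * powR t (suc (length C))) (blockN t) S
    blockN-∷ t v S uniq = begin
      N (v ∷ S) * powR t (suc (length S))
        ≈⟨ *-congʳ (N-∷ v S uniq) ⟩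
      splitSum (cycleCount v) N S * powR t (suc (length S))
        ≈⟨ splitSum-*ʳ _ _ _ S ⟩
      splitSum (λ C → cycleCount v C * powR t (suc (length S))) N S
        ≈⟨ splitSum-cong S (λ C B i → ≈-trans
             (*-congʳ (*-congˡ (≈-trans (reflexive (cong (λ k → powR t (suc k)) (Interleaving-length i)))
                                      (powR-+ t (suc (length C)) (length B)))))
             (solve 4 (λ a p q b → a :* (p :* q) :* b := a :* p :* (b :* q)) ≈-refl _ _ _ _)) ⟩
      _ ∎

    Û : ∀ {m} → (Fin m → K) → List (Fin n) → K
    Û x = permSum (blockSum x)

    Û-suc : ∀ {m} (x : Fin (suc m) → K) S →
      Û x S ≈ splitSum (blockN (x zero)) (Û (λ i → x (suc i))) S
    Û-suc x S = ≈-trans (permSum-cutSum _ _ S)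
      (splitSum-congˡ (λ C → permSum-length (path (nonArc D)) (powR (x zero)) C) S)

    Û-[] : ∀ {m} (x : Fin m → K) → Û x [] ≈ 1#
    Û-[] x = blockSum-[] x

    permSum-zero : (F : List (Fin n) → K) → (∀ y → F y ≈ 0#) → ∀ S → permSum F S ≈ 0#
    permSum-zero F h S = ≈-trans (permSum-cong (λ y → ≈-trans (h y) (≈-sym (zeroˡ 0#))) S)
      (≈-trans (permSum-*ʳ (λ _ → 0#) 0# S) (zeroʳ _))

    -- By the Leibniz rule `v` falls either to the first variable or to the others. In both cases
    -- the cycle of `v` factors out and leaves the whole product behind, so the two cycle factors
    -- add, and with them the powers of the variables.
    Û-∷ : ∀ {m} (x : Fin m → K) v S → Unique (v ∷ S) →
      Û x (v ∷ S) ≈ splitSum (λ C → cycleCount v C * p x (suc (length C))) (Û x) S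
    -- Without variables both sides vanish: a nonempty listing has no colouring, and every power sum
    -- is empty.
    Û-∷ {zero} x v S uniq = ≈-trans (permSum-zero _ insSum-zero S) (≈-sym (≈-trans
        (splitSum-cong {g′ = Û x} S (λ C B _ → *-congʳ (≈-trans (zeroʳ _) (≈-sym (zeroʳ 0#)))))
        (≈-trans (≈-sym (splitSum-*ʳ (λ _ → 0#) (Û x) 0# S)) (zeroʳ _))))
      where
      insSum-zero : ∀ y → insSum v (blockSum x) y ≈ 0#
      insSum-zero [] = ≈-refl
      insSum-zero (y ∷ ys) = ≈-trans (+-identityˡ _) (go y ys)
        where
        go : ∀ y ys → insSum v (λ z → blockSum x (y ∷ z)) ys ≈ 0#
        go y [] = ≈-refl
        go y (_ ∷ ys) = ≈-trans (+-identityˡ _) (go y ys)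
    Û-∷ {suc m} x v S uniq = begin
      Û x (v ∷ S)
        ≈⟨ Û-suc x (v ∷ S) ⟩
      splitSum (λ C → blockN t (v ∷ C)) (Û x′) S + splitSum (blockN t) (λ B → Û x′ (v ∷ B)) S
        ≈⟨ +-cong
             (splitSum-cong S (λ C B i → *-congʳ (blockN-∷ t v C (AllPairs-Interleaving (consˡ i) uniq))))
             (splitSum-cong S (λ C B i → *-congˡ (Û-∷ x′ v B (AllPairs-Interleaving (consˡ (swap i)) uniq)))) ⟩
      splitSum (splitSum f (blockN t)) (Û x′) S + splitSum (blockN t) (splitSum g (Û x′)) S
        ≈⟨ +-cong (splitSum-assoc f _ _ S) (splitSum-left-comm _ g _ S) ⟩
      splitSum f (splitSum (blockN t) (Û x′)) S + splitSum g (splitSum (blockN t) (Û x′)) S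
        ≈⟨ splitSum-+ˡ f g _ S ⟨
      splitSum (λ C → f C + g C) (splitSum (blockN t) (Û x′)) S
        ≈⟨ splitSum-cong S (λ C B _ → *-cong
             (≈-trans (≈-sym (distribˡ _ _ _)) (*-congˡ (reflexive (sym (∑-allFin-suc (λ j → powR (x j) (suc (length C))))))))
             (≈-sym (Û-suc x B))) ⟩
      splitSum (λ C → cycleCount v C * p x (suc (length C))) (Û x) S ∎
      where
      t : K
      t = x zero
      x′ : Fin m → K
      x′ i = x (suc i)
      f g : List (Fin n) → K
      f C = cycleCount v C * powR t (suc (length C))
      g C = cycleCount v C * p x′ (suc (length C))

    cycleTerm : ∀ {m} → (Fin m → K) → List (Fin n) → K
    cycleTerm x c = natR (cycleWeight D c) * p x (length c)

    Û-cycleTerm : ∀ {m} (x : Fin m → K) v S → Unique (v ∷ S) →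
      Û x (v ∷ S) ≈ splitSum (permSum (λ c → cycleTerm x (v ∷ c))) (Û x) S
    Û-cycleTerm x v S uniq = ≈-trans (Û-∷ x v S uniq)
      (splitSum-congˡ (λ C → ≈-sym (permSum-length _ (λ k → p x (suc k)) C)) S)

-- Enumerating permutations and cycle structures

unique-head∉ : {x : A} {xs : List A} → All (x ≢_) xs → x ∉ xs
unique-head∉ x≢ x∈ = All.lookup x≢ x∈ refl

unique-⊆-↭ : {xs ys : List A} → Unique xs → xs ⊆ ys → length ys ≤ length xs → xs ↭ ys
unique-⊆-↭ {ys = []} [] _ _ = ↭-refl
unique-⊆-↭ {xs = x ∷ xs} (x≢ ∷ uniq) sub le with ∈-∃++ (sub (here refl))
... | us , vs , refl = ↭-trans (prep x (unique-⊆-↭ uniq sub′ le′)) (↭-sym (shift x us vs))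
  where
  sub′ : xs ⊆ us ++ vs
  sub′ {z} z∈ with ∈-resp-↭ (shift x us vs) (sub (there z∈))
  ... | here refl = contradiction z∈ (unique-head∉ x≢)
  ... | there z∈′ = z∈′
  le′ : length (us ++ vs) ≤ length xs
  le′ = ℕ.s≤s⁻¹ (subst (_≤ suc (length xs)) (↭-length (shift x us vs)) le)

-- Since `g` recovers from an output the `x` that produced it, the lists for different `x` are
-- disjoint. Each enumeration below is shown to be free of repetitions by exhibiting such a `g`.
concatMap-unique : (f : A → List B) (g : B → A) {xs : List A} →
  (∀ {x y} → x ∈ xs → y ∈ f x → g y ≡ x) → (∀ {x} → x ∈ xs → Unique (f x)) →
  Unique xs → Unique (concatMap f xs)
concatMap-unique f g retract fibre [] = []
concatMap-unique f g {x ∷ xs} retract fibre (x≢ ∷ uniq) =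
  Uniqueₚ.++⁺ (fibre (here refl))
    (concatMap-unique f g (λ x∈ → retract (there x∈)) (λ x∈ → fibre (there x∈)) uniq)
    disjoint
  where
  disjoint : ∀ {y} → ¬ (y ∈ f x × y ∈ concatMap f xs)
  disjoint (y∈fx , y∈rest) with find (∈-concatMap⁻ f y∈rest)
  ... | x′ , x′∈ , y∈fx′ = unique-head∉ x≢
    (subst (_∈ xs) (trans (sym (retract (there x′∈) y∈fx′)) (retract (here refl) y∈fx)) x′∈)

ins : A → List A → List (List A)
ins x [] = (x ∷ []) ∷ []
ins x (y ∷ ys) = (x ∷ y ∷ ys) ∷ map (y ∷_) (ins x ys)

perms : List A → List (List A)
perms [] = [] ∷ []
perms (x ∷ S) = concatMap (ins x) (perms S)

addToEither : A → List A × List A → List (List A × List A)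
addToEither x CB = (x ∷ proj₁ CB , proj₂ CB) ∷ (proj₁ CB , x ∷ proj₂ CB) ∷ []

splits : List A → List (List A × List A)
splits [] = ([] , []) ∷ []
splits (x ∷ S) = concatMap (addToEither x) (splits S)

addCycle : A → List (List (List A)) → List A → List (List (List A))
addCycle v css c = map ((v ∷ c) ∷_) css

-- The permutations of S in cycle notation, each cycle starting with its first entry in S and
-- the cycles sorted by these; meaningful only if the first argument is at least the length of S.
cycleLists : ℕ → List A → List (List (List A))
cycleLists _ [] = [] ∷ []
cycleLists zero (_ ∷ _) = []
cycleLists (suc k) (v ∷ S) = concatMap
  (λ CB → concatMap (addCycle v (cycleLists k (proj₂ CB))) (perms (proj₁ CB))) (splits S)

-- What membership in `cycleLists` yields, freed of the bound, so that later proofs can recurse on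
-- the cycles.
data IsCycleList {A : Set} : List A → List (List A) → Set where
  [] : IsCycleList [] []
  cycle : ∀ {v S C B c cs} → Interleaving C B S → c ↭ C → IsCycleList B cs →
    IsCycleList (v ∷ S) ((v ∷ c) ∷ cs)

∈-ins⁻ : {x : A} (y : List A) {w : List A} → w ∈ ins x y → w ↭ x ∷ y
∈-ins⁻ [] (here refl) = ↭-refl
∈-ins⁻ (y ∷ ys) (here refl) = ↭-refl
∈-ins⁻ {x = x} (y ∷ ys) (there w∈) with ∈-map⁻ (y ∷_) w∈
... | w′ , w′∈ , refl = ↭-trans (prep y (∈-ins⁻ ys w′∈)) (↭.swap y x ↭-refl)

∈-ins⁺ : (x : A) (us vs : List A) → us ++ x ∷ vs ∈ ins x (us ++ vs)
∈-ins⁺ x [] [] = here refl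
∈-ins⁺ x [] (y ∷ vs) = here refl
∈-ins⁺ x (u ∷ us) vs = there (∈-map⁺ (u ∷_) (∈-ins⁺ x us vs))

∈-perms⁻ : (S : List A) {w : List A} → w ∈ perms S → w ↭ S
∈-perms⁻ [] (here refl) = ↭-refl
∈-perms⁻ (x ∷ S) w∈ with find (∈-concatMap⁻ (ins x) w∈)
... | y , y∈ , w∈y = ↭-trans (∈-ins⁻ y w∈y) (prep x (∈-perms⁻ S y∈))

∈-perms⁺ : (S : List A) {w : List A} → w ↭ S → w ∈ perms S
∈-perms⁺ [] w↭ rewrite ↭-empty-inv w↭ = here refl
∈-perms⁺ (x ∷ S) w↭ with ∈-∃++ (∈-resp-↭ (↭-sym w↭) (here refl))
... | us , vs , refl =
  ∈-concatMap⁺ (ins x) (lose (∈-perms⁺ S (drop-mid us [] w↭)) (∈-ins⁺ x us vs))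

∈-splits⁻ : (S : List A) {CB : List A × List A} → CB ∈ splits S → Interleaving (proj₁ CB) (proj₂ CB) S
∈-splits⁻ [] (here refl) = []
∈-splits⁻ (x ∷ S) CB∈ with find (∈-concatMap⁻ (addToEither x) {xs = splits S} CB∈)
... | _ , CB′∈ , here refl = consˡ (∈-splits⁻ S CB′∈)
... | _ , CB′∈ , there (here refl) = consʳ (∈-splits⁻ S CB′∈)

∈-cycleLists⁻ : (k : ℕ) (S : List A) {cs : List (List A)} → cs ∈ cycleLists k S → IsCycleList S cs
∈-cycleLists⁻ zero [] (here refl) = []
∈-cycleLists⁻ (suc k) [] (here refl) = []
∈-cycleLists⁻ (suc k) (v ∷ S) cs∈
  with find (∈-concatMap⁻ (λ CB → concatMap (addCycle v (cycleLists k (proj₂ CB))) (perms (proj₁ CB)))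
         {xs = splits S} cs∈)
... | (C , B) , CB∈ , cs∈′ with find (∈-concatMap⁻ (addCycle v (cycleLists k B)) {xs = perms C} cs∈′)
... | c , c∈ , cs∈″ with ∈-map⁻ ((v ∷ c) ∷_) cs∈″
... | cs′ , cs′∈ , refl = cycle (∈-splits⁻ S CB∈) (∈-perms⁻ C c∈) (∈-cycleLists⁻ k B cs′∈)

filter-Interleaving : {P : A → Set} (P? : Decidable P) {C B S : List A} → Interleaving C B S →
  All P C → All (¬_ ∘ P) B → filter P? S ≡ C
filter-Interleaving P? [] _ _ = refl
filter-Interleaving P? (consˡ i) (p ∷ ps) nps =
  trans (filter-accept P? p) (cong (_ ∷_) (filter-Interleaving P? i ps nps))
filter-Interleaving P? (consʳ i) ps (np ∷ nps) =
  trans (filter-reject P? np) (filter-Interleaving P? i ps nps)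

Interleaving-disjoint : {C B S : List A} → Interleaving C B S → Unique S → ∀ {z} → z ∈ C → z ∉ B
Interleaving-disjoint (consˡ i) (x≢ ∷ uniq) (here refl) z∈B =
  All.lookup (All-Interleaving (swap i) x≢) z∈B refl
Interleaving-disjoint (consˡ i) (x≢ ∷ uniq) (there z∈C) z∈B = Interleaving-disjoint i uniq z∈C z∈B
Interleaving-disjoint (consʳ i) (x≢ ∷ uniq) z∈C (here refl) = All.lookup (All-Interleaving i x≢) z∈C refl
Interleaving-disjoint (consʳ i) (x≢ ∷ uniq) z∈C (there z∈B) = Interleaving-disjoint i uniq z∈C z∈B

-- Absence of repetitions in the enumerations

module Enumeration {A : Set} (_≟_ : DecidableEquality A) where
  open import Data.List.Membership.DecPropositional _≟_ using (_∈?_)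

  without : A → List A → List A
  without x = filter (λ z → ¬? (x ≟ z))

  without-∉ : {x : A} {w : List A} → All (x ≢_) w → without x w ≡ w
  without-∉ {x} x≢ = filter-all (λ z → ¬? (x ≟ z)) x≢

  without-ins : {x : A} {y w : List A} → All (x ≢_) y → w ∈ ins x y → without x w ≡ y
  without-ins {x} {[]} [] (here refl) = filter-reject (λ z → ¬? (x ≟ z)) (λ x≢x → x≢x refl)
  without-ins {x} {y ∷ ys} x≢ (here refl) =
    trans (filter-reject (λ z → ¬? (x ≟ z)) (λ x≢x → x≢x refl)) (without-∉ x≢)
  without-ins {x} {y ∷ ys} (x≢y ∷ x≢) (there w∈) with ∈-map⁻ (y ∷_) w∈
  ... | w′ , w′∈ , refl = trans (filter-accept (λ z → ¬? (x ≟ z)) x≢y) (cong (y ∷_) (without-ins x≢ w′∈))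

  ins-unique : {x : A} {y : List A} → All (x ≢_) y → Unique (ins x y)
  ins-unique [] = [] ∷ []
  ins-unique {x} {y ∷ ys} (x≢y ∷ x≢) =
    All.tabulate differs ∷ Uniqueₚ.map⁺ ∷-injectiveʳ (ins-unique x≢)
    where
    differs : ∀ {w} → w ∈ map (y ∷_) (ins x ys) → x ∷ y ∷ ys ≢ w
    differs w∈ eq with ∈-map⁻ (y ∷_) w∈
    ... | w′ , _ , refl = x≢y (∷-injectiveˡ eq)

  perms-unique : {S : List A} → Unique S → Unique (perms S)
  perms-unique [] = [] ∷ []
  perms-unique {x ∷ S} (x≢ ∷ uniq) = concatMap-unique (ins x) (without x)
    (λ y∈ w∈ → without-ins (fresh y∈) w∈) (λ y∈ → ins-unique (fresh y∈)) (perms-unique uniq)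
    where
    fresh : ∀ {y} → y ∈ perms S → All (x ≢_) y
    fresh y∈ = All-resp-↭ (↭-sym (∈-perms⁻ S y∈)) x≢

  splits-unique : {S : List A} → Unique S → Unique (splits S)
  splits-unique [] = [] ∷ []
  splits-unique {x ∷ S} (x≢ ∷ uniq) = concatMap-unique (addToEither x)
    (λ CB → without x (proj₁ CB) , without x (proj₂ CB)) retract (λ _ → ((λ ()) ∷ []) ∷ [] ∷ [])
    (splits-unique uniq)
    where
    drop-x : ∀ {w} → All (x ≢_) w → without x (x ∷ w) ≡ w
    drop-x x≢ = trans (filter-reject (λ z → ¬? (x ≟ z)) (λ x≢x → x≢x refl)) (without-∉ x≢)
    retract : ∀ {CB y} → CB ∈ splits S →
      y ∈ addToEither x CB →
      (without x (proj₁ y) , without x (proj₂ y)) ≡ CB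
    retract CB∈ y∈ with All-Interleaving (∈-splits⁻ S CB∈) x≢ | All-Interleaving (swap (∈-splits⁻ S CB∈)) x≢ | y∈
    ... | x≢C | x≢B | here refl = cong₂ _,_ (drop-x x≢C) (without-∉ x≢B)
    ... | x≢C | x≢B | there (here refl) = cong₂ _,_ (without-∉ x≢C) (drop-x x≢B)

  -- Recovers a split from the entries of its first part in any order, hence from the first cycle of
  -- a cycle list.
  splitBy : List A → List A → List A × List A
  splitBy S c = filter (_∈? c) S , filter (λ z → ¬? (z ∈? c)) S

  firstCycleTail : List (List A) → List A
  firstCycleTail ((_ ∷ c) ∷ _) = c
  firstCycleTail _ = []

  splitBy-Interleaving : {C B S c : List A} → Unique S → Interleaving C B S → c ↭ C → splitBy S c ≡ (C , B)
  splitBy-Interleaving {c = c} uniq i c↭C = cong₂ _,_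
    (filter-Interleaving (_∈? c) i (All.tabulate (∈-resp-↭ (↭-sym c↭C))) outside)
    (filter-Interleaving (λ z → ¬? (z ∈? c)) (swap i) outside
      (All.tabulate (λ z∈C z∉c → z∉c (∈-resp-↭ (↭-sym c↭C) z∈C))))
    where
    outside : All (_∉ c) _
    outside = All.tabulate (λ z∈B z∈c → Interleaving-disjoint i uniq (∈-resp-↭ c↭C z∈c) z∈B)

  cycleLists-unique : (k : ℕ) {S : List A} → Unique S → Unique (cycleLists k S)
  cycleLists-unique zero {[]} [] = [] ∷ []
  cycleLists-unique (suc k) {[]} [] = [] ∷ []
  cycleLists-unique zero {_ ∷ _} _ = []
  cycleLists-unique (suc k) {v ∷ S} (_ ∷ uniq) =
    concatMap-unique (λ CB → concatMap (addCycle v (cycleLists k (proj₂ CB))) (perms (proj₁ CB)))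
      (λ cs → splitBy S (firstCycleTail cs)) outer
      (λ {CB} CB∈ → concatMap-unique (addCycle v (cycleLists k (proj₂ CB))) firstCycleTail (inner {proj₂ CB})
        (λ _ → Uniqueₚ.map⁺ ∷-injectiveʳ
          (cycleLists-unique k (AllPairs-Interleaving (swap (∈-splits⁻ S CB∈)) uniq)))
        (perms-unique (AllPairs-Interleaving (∈-splits⁻ S CB∈) uniq)))
      (splits-unique uniq)
    where
    inner : ∀ {B cs c} {xs : List (List A)} → c ∈ xs → cs ∈ map ((v ∷ c) ∷_) (cycleLists k B) → firstCycleTail cs ≡ c
    inner {c = c} _ cs∈ with ∈-map⁻ ((v ∷ c) ∷_) cs∈
    ... | _ , _ , refl = refl
    outer : ∀ {CB cs} → CB ∈ splits S →
      cs ∈ concatMap (addCycle v (cycleLists k (proj₂ CB))) (perms (proj₁ CB)) →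
      splitBy S (firstCycleTail cs) ≡ CB
    outer {C , B} CB∈ cs∈ with find (∈-concatMap⁻ (addCycle v (cycleLists k B)) {xs = perms C} cs∈)
    ... | c , c∈ , cs∈′ with ∈-map⁻ ((v ∷ c) ∷_) cs∈′
    ... | _ , _ , refl = splitBy-Interleaving uniq (∈-splits⁻ S CB∈) (∈-perms⁻ C c∈)

-- Sums over the enumerations and the solution of the recursion

module EnumerationSums {c ℓ : Level} (R : CommutativeSemiring c ℓ) where
  open CommutativeSemiring R hiding (zero; refl; sym; trans) renaming (Carrier to K)
  open CommutativeSemiring R using () renaming (refl to ≈-refl; sym to ≈-sym; trans to ≈-trans)
  open Eval R
  open ShuffleAlgebra R
  open FiniteSums R
  open import Algebra.Solver.Ring.NaturalCoefficients.Default R using (solve; _:+_; _:*_; _:=_; con)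
  open import Relation.Binary.Reasoning.Setoid setoid

  ∑-+ : {B : Set} (F G : B → K) (xs : List B) → ∑ (λ y → F y + G y) xs ≈ ∑ F xs + ∑ G xs
  ∑-+ F G [] = ≈-sym (+-identityˡ 0#)
  ∑-+ F G (y ∷ xs) = ≈-trans (+-congˡ (∑-+ F G xs))
    (solve 4 (λ a b c d → a :+ b :+ (c :+ d) := a :+ c :+ (b :+ d)) ≈-refl _ _ _ _)

  insSum-ins : (F : List A → K) (x : A) (y : List A) → insSum x F y ≈ ∑ F (ins x y)
  insSum-ins F x [] = ≈-sym (+-identityʳ _)
  insSum-ins F x (y ∷ ys) = +-congˡ
    (≈-trans (insSum-ins _ x ys) (reflexive (sym (∑-map F (y ∷_) (ins x ys)))))

  permSum-perms : (F : List A → K) (S : List A) → permSum F S ≈ ∑ F (perms S)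
  permSum-perms F [] = ≈-sym (+-identityʳ _)
  permSum-perms F (x ∷ S) = begin
    permSum (insSum x F) S            ≈⟨ permSum-perms _ S ⟩
    ∑ (insSum x F) (perms S)          ≈⟨ ∑-cong (insSum-ins F x) (perms S) ⟩
    ∑ (λ y → ∑ F (ins x y)) (perms S) ≈⟨ ∑-concatMap F (ins x) (perms S) ⟨
    ∑ F (perms (x ∷ S))               ∎

  splitSum-splits : (f g : List A → K) (S : List A) →
    splitSum f g S ≈ ∑ (λ CB → f (proj₁ CB) * g (proj₂ CB)) (splits S)
  splitSum-splits f g [] = ≈-sym (+-identityʳ _)
  splitSum-splits f g (x ∷ S) = begin
    splitSum (λ C → f (x ∷ C)) g S + splitSum f (λ B → g (x ∷ B)) S
      ≈⟨ +-cong (splitSum-splits _ g S) (splitSum-splits f _ S) ⟩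
    ∑ (λ CB → f (x ∷ proj₁ CB) * g (proj₂ CB)) (splits S) + ∑ (λ CB → f (proj₁ CB) * g (x ∷ proj₂ CB)) (splits S)
      ≈⟨ ∑-+ _ _ (splits S) ⟨
    ∑ (λ CB → f (x ∷ proj₁ CB) * g (proj₂ CB) + f (proj₁ CB) * g (x ∷ proj₂ CB)) (splits S)
      ≈⟨ ∑-cong (λ CB → +-congˡ (≈-sym (+-identityʳ _))) (splits S) ⟩
    ∑ (λ CB → ∑ (λ CB′ → f (proj₁ CB′) * g (proj₂ CB′)) (addToEither x CB)) (splits S)
      ≈⟨ ∑-concatMap _ (addToEither x) (splits S) ⟨
    _ ∎

  ∑-*ʳ : {B : Set} (F : B → K) (k : K) (xs : List B) → ∑ (λ y → F y * k) xs ≈ ∑ F xs * k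
  ∑-*ʳ F k xs = ≈-trans (∑-cong (λ _ → *-comm _ k) xs) (≈-trans (∑-*ˡ k F xs) (*-comm k _))

  -- Unfolding the recursion splits off one cycle at a time until the list is empty. The bound `k`
  -- makes this terminate, as the rest `B` of a split is shorter than `v ∷ S` but not structurally
  -- smaller.
  ∑-cycleLists : (ω : List A → K) (f : List A → K) → f [] ≈ 1# →
    (∀ v S → Unique (v ∷ S) → f (v ∷ S) ≈ splitSum (permSum (λ c → ω (v ∷ c))) f S) →
    ∀ k S → Unique S → length S ≤ k → f S ≈ ∑ (λ cs → prodR (map ω cs)) (cycleLists k S)
  ∑-cycleLists ω f f-[] f-∷ zero [] _ _ = ≈-trans f-[] (≈-sym (+-identityʳ _))
  ∑-cycleLists ω f f-[] f-∷ (suc k) [] _ _ = ≈-trans f-[] (≈-sym (+-identityʳ _))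
  ∑-cycleLists {A} ω f f-[] f-∷ (suc k) (v ∷ S) uniq@(_ ∷ uniqS) (s≤s le) = begin
    f (v ∷ S)
      ≈⟨ f-∷ v S uniq ⟩
    splitSum (permSum (λ c → ω (v ∷ c))) f S
      ≈⟨ splitSum-cong S (λ C B i → *-cong (permSum-perms _ C)
           (∑-cycleLists ω f f-[] f-∷ k B (AllPairs-Interleaving (swap i) uniqS) (shorter i))) ⟩
    splitSum (λ C → ∑ (λ c → ω (v ∷ c)) (perms C)) (λ B → ∑ W (cycleLists k B)) S
      ≈⟨ splitSum-splits _ _ S ⟩
    ∑ (λ CB → ∑ (λ c → ω (v ∷ c)) (perms (proj₁ CB)) * ∑ W (cycleLists k (proj₂ CB))) (splits S)
      ≈⟨ ∑-cong expand (splits S) ⟩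
    ∑ (λ CB → ∑ W (concatMap (addCycle v (cycleLists k (proj₂ CB))) (perms (proj₁ CB)))) (splits S)
      ≈⟨ ∑-concatMap W (λ CB → concatMap (addCycle v (cycleLists k (proj₂ CB))) (perms (proj₁ CB))) (splits S) ⟨
    ∑ W (cycleLists (suc k) (v ∷ S)) ∎
    where
    W : List (List A) → K
    W cs = prodR (map ω cs)
    shorter : ∀ {C B} → Interleaving C B S → length B ≤ k
    shorter {C} {B} i = ℕₚ.≤-trans (subst (length B ≤_) (sym (Interleaving-length i)) (ℕₚ.m≤n+m _ (length C))) le
    expand : ∀ CB → ∑ (λ c → ω (v ∷ c)) (perms (proj₁ CB)) * ∑ W (cycleLists k (proj₂ CB)) ≈
      ∑ W (concatMap (addCycle v (cycleLists k (proj₂ CB))) (perms (proj₁ CB)))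
    expand (C , B) = begin
      ∑ (λ c → ω (v ∷ c)) (perms C) * ∑ W (cycleLists k B)
        ≈⟨ ∑-*ʳ _ _ (perms C) ⟨
      ∑ (λ c → ω (v ∷ c) * ∑ W (cycleLists k B)) (perms C)
        ≈⟨ ∑-cong (λ c → ≈-trans (≈-sym (∑-*ˡ _ W (cycleLists k B)))
                                 (reflexive (sym (∑-map W ((v ∷ c) ∷_) (cycleLists k B))))) (perms C) ⟩
      ∑ (λ c → ∑ W (map ((v ∷ c) ∷_) (cycleLists k B))) (perms C)
        ≈⟨ ∑-concatMap W (addCycle v (cycleLists k B)) (perms C) ⟨
      _ ∎

  ∑-cong-∈ : {B : Set} {F G : B → K} (xs : List B) → (∀ y → y ∈ xs → F y ≈ G y) → ∑ F xs ≈ ∑ G xs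
  ∑-cong-∈ [] h = ≈-refl
  ∑-cong-∈ (y ∷ xs) h = +-cong (h y (here refl)) (∑-cong-∈ xs (λ z z∈ → h z (there z∈)))

-- With all weights 1 the number of arrangements obeys the same recursion: a place for `v` in `y` is
-- the same as a cut of `y` into two parts.
length-cycleLists : (k : ℕ) (S : List A) → Unique S → length S ≤ k →
  length (cycleLists k S) ≡ length (perms S)
length-cycleLists {A} k S uniq le = begin
  length (cycleLists k S)
    ≡⟨ ∑-1 (cycleLists k S) ⟨
  ∑ (λ _ → 1) (cycleLists k S)
    ≡⟨ ∑-cong prod-1 (cycleLists k S) ⟨
  ∑ (λ cs → prodR (map (λ _ → 1) cs)) (cycleLists k S)
    ≡⟨ ∑-cycleLists (λ _ → 1) (permSum (λ _ → 1)) refl recursion k S uniq le ⟨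
  permSum (λ _ → 1) S
    ≡⟨ permSum-perms _ S ⟩
  ∑ (λ _ → 1) (perms S)
    ≡⟨ ∑-1 (perms S) ⟩
  length (perms S) ∎
  where
  open ≡.≡-Reasoning
  open Eval ℕ-semiring
  open ShuffleAlgebra ℕ-semiring
  open FiniteSums ℕ-semiring
  open EnumerationSums ℕ-semiring
  ∑-1 : {B : Set} (xs : List B) → ∑ (λ _ → 1) xs ≡ length xs
  ∑-1 [] = refl
  ∑-1 (x ∷ xs) = cong suc (∑-1 xs)
  prod-1 : (cs : List (List A)) → prodR (map (λ _ → 1) cs) ≡ 1
  prod-1 [] = refl
  prod-1 (c ∷ cs) = trans (ℕₚ.*-identityˡ _) (prod-1 cs)
  insSum-1 : (v : A) (y : List A) → insSum v (λ _ → 1) y ≡ cutSum (λ _ → 1) (λ _ → 1) y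
  insSum-1 v [] = refl
  insSum-1 v (y ∷ ys) = cong suc (insSum-1 v ys)
  recursion : (v : A) (S : List A) → Unique (v ∷ S) → permSum (λ _ → 1) (v ∷ S) ≡
    splitSum (permSum (λ _ → 1)) (permSum (λ _ → 1)) S
  recursion v S _ = trans (permSum-cong (insSum-1 v) S) (permSum-cutSum (λ _ → 1) (λ _ → 1) S)

-- Listings as duplicate-free vectors

∈-filterᵇ⁺ : (q : A → Bool) {y : A} {xs : List A} → y ∈ xs → q y ≡ true → y ∈ filterᵇ q xs
∈-filterᵇ⁺ q {y} {x ∷ xs} (here refl) qy rewrite qy = here refl
∈-filterᵇ⁺ q {y} {x ∷ xs} (there y∈) qy with q x
... | true = there (∈-filterᵇ⁺ q y∈ qy)
... | false = ∈-filterᵇ⁺ q y∈ qy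

∈-filterᵇ⁻ : (q : A → Bool) {y : A} (xs : List A) → y ∈ filterᵇ q xs → y ∈ xs × q y ≡ true
∈-filterᵇ⁻ q (x ∷ xs) y∈ with q x in eq
∈-filterᵇ⁻ q (x ∷ xs) (here refl) | true = here refl , eq
∈-filterᵇ⁻ q (x ∷ xs) (there y∈) | true with ∈-filterᵇ⁻ q xs y∈
... | y∈′ , qy = there y∈′ , qy
∈-filterᵇ⁻ q (x ∷ xs) y∈ | false with ∈-filterᵇ⁻ q xs y∈
... | y∈′ , qy = there y∈′ , qy

filterᵇ-unique : (q : A → Bool) {xs : List A} → Unique xs → Unique (filterᵇ q xs)
filterᵇ-unique q [] = []
filterᵇ-unique q {x ∷ xs} (x≢ ∷ uniq) with q x
... | false = filterᵇ-unique q uniq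
... | true = All.tabulate (λ y∈ → All.lookup x≢ (proj₁ (∈-filterᵇ⁻ q xs y∈))) ∷ filterᵇ-unique q uniq

∈-vecs : {k : ℕ} (w : Vec (Fin n) k) → w ∈ vecs (allFin n) k
∈-vecs []ᵛ = here refl
∈-vecs (a ∷ᵛ w) = ∈-concatMap⁺ _ (lose (∈-allFin a) (∈-map⁺ (a ∷ᵛ_) (∈-vecs w)))

vecs-unique : (n k : ℕ) → Unique (vecs (allFin n) k)
vecs-unique n zero = [] ∷ []
vecs-unique n (suc k) = concatMap-unique _ Vec.head retract
  (λ _ → Uniqueₚ.map⁺ Vecₚ.∷-injectiveʳ (vecs-unique n k)) (Uniqueₚ.allFin⁺ n)
  where
  retract : ∀ {a w} → a ∈ allFin n → w ∈ map (a ∷ᵛ_) (vecs (allFin n) k) → Vec.head w ≡ a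
  retract {a} _ w∈ with ∈-map⁻ (a ∷ᵛ_) w∈
  ... | _ , _ , refl = refl

eqᶠ-refl : (i : Fin n) → eqᶠ i i ≡ true
eqᶠ-refl i with i ≟ᶠ i
... | yes _ = refl
... | no i≢i = contradiction refl i≢i

eqᶠ-≢ : {i j : Fin n} → i ≢ j → eqᶠ i j ≡ false
eqᶠ-≢ {i = i} {j} i≢j with i ≟ᶠ j
... | yes i≡j = contradiction i≡j i≢j
... | no _ = refl

anyᵇ-eqᶠ⁺ : {x : Fin n} {xs : List (Fin n)} → All (x ≢_) xs → anyᵇ (eqᶠ x) xs ≡ false
anyᵇ-eqᶠ⁺ [] = refl
anyᵇ-eqᶠ⁺ (x≢y ∷ x≢) rewrite eqᶠ-≢ x≢y = anyᵇ-eqᶠ⁺ x≢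

anyᵇ-eqᶠ⁻ : {x : Fin n} (xs : List (Fin n)) → anyᵇ (eqᶠ x) xs ≡ false → All (x ≢_) xs
anyᵇ-eqᶠ⁻ [] _ = []
anyᵇ-eqᶠ⁻ {x = x} (y ∷ xs) h with x ≟ᶠ y
... | no x≢y = x≢y ∷ anyᵇ-eqᶠ⁻ xs h

distinct⁺ : {xs : List (Fin n)} → Unique xs → distinct xs ≡ true
distinct⁺ [] = refl
distinct⁺ (x≢ ∷ uniq) rewrite anyᵇ-eqᶠ⁺ x≢ = distinct⁺ uniq

distinct⁻ : (xs : List (Fin n)) → distinct xs ≡ true → Unique xs
distinct⁻ [] _ = []
distinct⁻ (x ∷ xs) h with anyᵇ (eqᶠ x) xs in eq
... | false = anyᵇ-eqᶠ⁻ xs eq ∷ distinct⁻ xs h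

∈-listings⁺ : {w : Vec (Fin n) n} → Unique (toList w) → w ∈ listings n
∈-listings⁺ {w = w} uniq = ∈-filterᵇ⁺ _ (∈-vecs w) (distinct⁺ uniq)

∈-listings⁻ : {w : Vec (Fin n) n} → w ∈ listings n → Unique (toList w)
∈-listings⁻ {n} {w} w∈ = distinct⁻ (toList w) (proj₂ (∈-filterᵇ⁻ _ (vecs (allFin n) n) w∈))

listings-unique : (n : ℕ) → Unique (listings n)
listings-unique n = filterᵇ-unique _ (vecs-unique n n)

length-allFin : (n : ℕ) → length (allFin n) ≡ n
length-allFin n = length-tabulate {n = n} (λ i → i)

listings↭perms : (n : ℕ) → map toList (listings n) ↭ perms (allFin n)
listings↭perms n = ∼bag⇒↭ (unique∧set⇒bag
  (Uniqueₚ.map⁺ toList-inj (listings-unique n)) (perms-unique (Uniqueₚ.allFin⁺ n)) (mk⇔ to from))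
  where
  open Enumeration (_≟ᶠ_ {n})
  toList-inj : {v w : Vec (Fin n) n} → toList v ≡ toList w → v ≡ w
  toList-inj {v} {w} eq = trans (sym (Vecₚ.cast-is-id refl v)) (Vecₚ.toList-injective refl v w eq)
  fromLength : ∀ {k} (w : List (Fin n)) → length w ≡ k → ∃ λ (v : Vec (Fin n) k) → toList v ≡ w
  fromLength w refl = Vec.fromList w , Vecₚ.toList∘fromList w
  to : ∀ {w} → w ∈ map toList (listings n) → w ∈ perms (allFin n)
  to w∈ with ∈-map⁻ toList w∈
  ... | v , v∈ , refl = ∈-perms⁺ (allFin n) (unique-⊆-↭ (∈-listings⁻ v∈) (λ {z} _ → ∈-allFin z)
    (ℕₚ.≤-reflexive (trans (length-allFin n) (sym (Vecₚ.length-toList v)))))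
  from : ∀ {w} → w ∈ perms (allFin n) → w ∈ map toList (listings n)
  from {w} w∈ with ∈-perms⁻ (allFin n) w∈
  ... | w↭ with fromLength w (trans (↭-length w↭) (length-allFin n))
  ... | v , refl = ∈-map⁺ toList (∈-listings⁺ (Unique-resp-↭ (↭-sym w↭) (Uniqueₚ.allFin⁺ n)))

-- From cycle structures to permutations

walkArcs : A → List A → A → List (A × A)
walkArcs a [] z = (a , z) ∷ []
walkArcs a (y ∷ c) z = (a , y) ∷ walkArcs y c z

cycleArcs : List A → List (A × A)
cycleArcs [] = []
cycleArcs (v ∷ c) = walkArcs v c v

sources-walkArcs : (a : A) (c : List A) (z : A) → map proj₁ (walkArcs a c z) ≡ a ∷ c
sources-walkArcs a [] z = refl
sources-walkArcs a (y ∷ c) z = cong (a ∷_) (sources-walkArcs y c z)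

targets-walkArcs : (a : A) (c : List A) (z : A) → map proj₂ (walkArcs a c z) ≡ c ++ z ∷ []
targets-walkArcs a [] z = refl
targets-walkArcs a (y ∷ c) z = cong (y ∷_) (targets-walkArcs y c z)

sources-cycleArcs : (cs : List (List A)) → map proj₁ (concatMap cycleArcs cs) ≡ concat cs
sources-cycleArcs [] = refl
sources-cycleArcs ([] ∷ cs) = sources-cycleArcs cs
sources-cycleArcs ((v ∷ c) ∷ cs) = trans (map-++ proj₁ (walkArcs v c v) _)
  (cong₂ _++_ (sources-walkArcs v c v) (sources-cycleArcs cs))

targets-cycleArcs : (cs : List (List A)) → map proj₂ (concatMap cycleArcs cs) ↭ concat cs
targets-cycleArcs [] = ↭-refl
targets-cycleArcs ([] ∷ cs) = targets-cycleArcs cs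
targets-cycleArcs ((v ∷ c) ∷ cs) = ↭-trans (↭-reflexive (map-++ proj₂ (walkArcs v c v) _))
  (++⁺ (↭-trans (↭-reflexive (targets-walkArcs v c v)) (↭-sym (∷↭∷ʳ v c))) (targets-cycleArcs cs))

concat-IsCycleList : {S : List A} {cs : List (List A)} → IsCycleList S cs → concat cs ↭ S
concat-IsCycleList [] = ↭-refl
concat-IsCycleList (cycle i c↭C cl) =
  prep _ (↭-trans (++⁺ c↭C (concat-IsCycleList cl)) (↭-sym (toPermutation i)))

target : List (Fin n × Fin n) → Fin n → Fin n
target [] x = x
target ((a , z) ∷ ps) x = if eqᶠ x a then z else target ps x

target-∈ : (ps : List (Fin n × Fin n)) → Unique (map proj₁ ps) →
  All (λ az → target ps (proj₁ az) ≡ proj₂ az) ps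
target-∈ [] _ = []
target-∈ ((a , z) ∷ ps) (a≢ ∷ uniq) =
  cong (λ q → if q then z else target ps a) (eqᶠ-refl a) ∷
  All.tabulate (λ {bw} bw∈ → trans
    (cong (λ q → if q then z else target ps (proj₁ bw))
      (eqᶠ-≢ (λ b≡a → All.lookup a≢ (∈-map⁺ proj₁ bw∈) (sym b≡a))))
    (All.lookup (target-∈ ps uniq) bw∈))

fromCycles : List (List (Fin n)) → Vec (Fin n) n
fromCycles cs = Vec.tabulate (target (concatMap cycleArcs cs))

toList-tabulate : {k : ℕ} (f : Fin k → A) → toList (Vec.tabulate f) ≡ tabulate f
toList-tabulate {k = zero} f = refl
toList-tabulate {k = suc k} f = cong (f zero ∷_) (toList-tabulate (f ∘ suc))

Follows : Vec (Fin n) n → List (Fin n × Fin n) → Set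
Follows σ = All (λ az → lookup σ (proj₁ az) ≡ proj₂ az)

module _ {n : ℕ} {cs : List (List (Fin n))} (cl : IsCycleList (allFin n) cs) where
  private
    ps : List (Fin n × Fin n)
    ps = concatMap cycleArcs cs

    sources↭ : map proj₁ ps ↭ allFin n
    sources↭ = ↭-trans (↭-reflexive (sources-cycleArcs cs)) (concat-IsCycleList cl)

    targets-follow : All (λ az → target ps (proj₁ az) ≡ proj₂ az) ps
    targets-follow = target-∈ ps (Unique-resp-↭ (↭-sym sources↭) (Uniqueₚ.allFin⁺ n))

  fromCycles-follows : Follows (fromCycles cs) ps
  fromCycles-follows = All.map (trans (Vecₚ.lookup∘tabulate (target ps) _)) targets-follow

  -- The targets of the arcs of a cycle are a rotation of its sources, so over all cycles the values
  -- again run through every vertex once.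
  fromCycles-listing : fromCycles cs ∈ listings n
  fromCycles-listing = ∈-listings⁺ (Unique-resp-↭ (↭-sym toList↭) (Uniqueₚ.allFin⁺ n))
    where
    open ↭.PermutationReasoning
    toList↭ : toList (fromCycles cs) ↭ allFin n
    toList↭ = begin
      toList (fromCycles cs)         ≡⟨ toList-tabulate (target ps) ⟩
      tabulate (target ps)           ≡⟨ map-tabulate (λ i → i) (target ps) ⟨
      map (target ps) (allFin n)     ↭⟨ map⁺ (target ps) sources↭ ⟨
      map (target ps) (map proj₁ ps) ≡⟨ map-∘ ps ⟨
      map (target ps ∘ proj₁) ps     ≡⟨ map-cong-local targets-follow ⟩
      map proj₂ ps                   ↭⟨ targets-cycleArcs cs ⟩
      concat cs                      ↭⟨ concat-IsCycleList cl ⟩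
      allFin n                       ∎

-- Recovering the cycles of a permutation

iter-suc : (σ : Vec (Fin n) n) (k : ℕ) (i : Fin n) → iter σ (suc k) i ≡ iter σ k (lookup σ i)
iter-suc σ zero i = refl
iter-suc σ (suc k) i = cong (lookup σ) (iter-suc σ k i)

applyUpTo-cong : {f g : ℕ → A} → (∀ k → f k ≡ g k) → ∀ N → applyUpTo f N ≡ applyUpTo g N
applyUpTo-cong h zero = refl
applyUpTo-cong h (suc N) = cong₂ _∷_ (h 0) (applyUpTo-cong (h ∘ suc) N)

allᵇ-cong : {q r : A → Bool} → (∀ y → q y ≡ r y) → ∀ xs → allᵇ q xs ≡ allᵇ r xs
allᵇ-cong h [] = refl
allᵇ-cong h (x ∷ xs) = cong₂ _∧_ (h x) (allᵇ-cong h xs)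

allᵇ-true : {q : A → Bool} → (∀ y → q y ≡ true) → ∀ xs → allᵇ q xs ≡ true
allᵇ-true h [] = refl
allᵇ-true h (x ∷ xs) rewrite h x = allᵇ-true h xs

allᵇ-false : {q : A → Bool} {y : A} {xs : List A} → y ∈ xs → q y ≡ false → allᵇ q xs ≡ false
allᵇ-false (here refl) qy rewrite qy = refl
allᵇ-false {q = q} {xs = x ∷ xs} (there y∈) qy =
  trans (cong (q x ∧_) (allᵇ-false y∈ qy)) (∧-zeroʳ (q x))

allᵇ-applyUpTo : (q : B → Bool) (h : A → B) (g : ℕ → A) (N : ℕ) →
  allᵇ q (applyUpTo (h ∘ g) N) ≡ allᵇ (q ∘ h) (applyUpTo g N)
allᵇ-applyUpTo q h g zero = refl
allᵇ-applyUpTo q h g (suc N) = cong (q (h (g 0)) ∧_) (allᵇ-applyUpTo q h (g ∘ suc) N)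

takeWhileᵇ-++ : {v : Fin n} {c rest : List (Fin n)} → All (v ≢_) c →
  takeWhileᵇ (λ z → not (eqᶠ z v)) (c ++ v ∷ rest) ≡ c
takeWhileᵇ-++ {v = v} [] rewrite eqᶠ-refl v = refl
takeWhileᵇ-++ (v≢y ∷ v≢) rewrite eqᶠ-≢ (λ y≡v → v≢y (sym y≡v)) = cong (_ ∷_) (takeWhileᵇ-++ v≢)

filterᵇ-Interleaving : (q : A → Bool) {C B S : List A} → Interleaving C B S →
  All (λ z → q z ≡ false) C → filterᵇ q S ≡ filterᵇ q B
filterᵇ-Interleaving q [] [] = refl
filterᵇ-Interleaving q (consˡ i) (qz ∷ qs) rewrite qz = filterᵇ-Interleaving q i qs
filterᵇ-Interleaving q {S = x ∷ S} (consʳ i) qs with q x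
... | true = cong (x ∷_) (filterᵇ-Interleaving q i qs)
... | false = filterᵇ-Interleaving q i qs

firsts : List (List A) → List A
firsts [] = []
firsts ([] ∷ cs) = firsts cs
firsts ((v ∷ _) ∷ cs) = v ∷ firsts cs

-- Formed so that its length is `cycLen σ v` by definition; an equation for the orbit then also
-- gives the cycle length.
orbit : Vec (Fin n) n → Fin n → List (Fin n)
orbit {n} σ v = v ∷ takeWhileᵇ (λ z → not (eqᶠ z v)) (map (λ k → iter σ (suc k) v) (upTo n))

toCycles : Vec (Fin n) n → List (List (Fin n))
toCycles σ = map (orbit σ) (reps σ)

module CycleOf {n : ℕ} (σ : Vec (Fin n) n) where

  -- The walk arrives at `z` after `suc (length c)` steps; the bound on `N` ensures that this
  -- arrival lies within the iterates considered.
  orbit-prefix : ∀ {a z} c → Follows σ (walkArcs a c z) → ∀ {N} → length c < N →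
    ∃ λ rest → applyUpTo (λ k → iter σ (suc k) a) N ≡ c ++ z ∷ rest
  orbit-prefix {a} [] (a→z ∷ []) {suc N} (s≤s le) =
    applyUpTo (λ k → iter σ (suc (suc k)) a) N , cong (_∷ _) a→z
  orbit-prefix {a} (y ∷ c) (a→y ∷ fol) {suc N} (s≤s le) with orbit-prefix c fol le
  ... | rest , eq = rest , cong₂ _∷_ a→y (trans (applyUpTo-cong shifted N) eq)
    where
    shifted : ∀ k → iter σ (suc (suc k)) a ≡ iter σ (suc k) y
    shifted k = trans (iter-suc σ (suc k) a) (cong (iter σ (suc k)) a→y)

  isDCycle-walk : (D : Digraph n) → ∀ a c z → Follows σ (walkArcs a c z) →
    allᵇ (λ k → D (iter σ k a) (iter σ (suc k) a)) (upTo (suc (length c))) ≡ isWalk D a c z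
  isDCycle-walk D a [] z (a→z ∷ []) = trans (∧-identityʳ _) (cong (D a) a→z)
  isDCycle-walk D a (y ∷ c) z (a→y ∷ fol) = cong₂ _∧_ (cong (D a) a→y)
    (trans (allᵇ-applyUpTo _ suc (λ k → k) (suc (length c)))
      (trans (allᵇ-cong (λ k → cong₂ D (shifted k) (cong (lookup σ) (shifted k))) (upTo (suc (length c))))
             (isDCycle-walk D y c z fol)))
    where
    shifted : ∀ k → iter σ (suc k) a ≡ iter σ k y
    shifted k = trans (iter-suc σ k a) (cong (iter σ k) a→y)

  iter-walk : ∀ {a z} c → Follows σ (walkArcs a c z) → iter σ (suc (length c)) a ≡ z
  iter-walk [] (a→z ∷ []) = a→z
  iter-walk {a} (y ∷ c) (a→y ∷ fol) =
    trans (iter-suc σ (suc (length c)) a) (trans (cong (iter σ (suc (length c))) a→y) (iter-walk c fol))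

  reach : ∀ {a z c x} → Follows σ (walkArcs a c z) → x ∈ c → ∃ λ k → k ≤ length c × iter σ k x ≡ z
  reach {c = y ∷ c} (_ ∷ fol) (here refl) = suc (length c) , ℕₚ.≤-refl , iter-walk c fol
  reach (_ ∷ fol) (there x∈) with reach fol x∈
  ... | k , k≤ , eq = k , ℕₚ.m≤n⇒m≤1+n k≤ , eq

  module _ {v : Fin n} {c : List (Fin n)} (v<c : All (v Fin.<_) c) (fol : Follows σ (walkArcs v c v)) where

    isRep-first : isRep σ v ≡ true
    isRep-first = allᵇ-true (λ k → Equivalence.to T-≡ (ℕₚ.≤⇒≤ᵇ (All.lookup v≤ (iter-∈ k)))) (upTo n)
      where
      v≤ : All (λ z → toℕ v ≤ toℕ z) (v ∷ c)
      v≤ = ℕₚ.≤-refl ∷ All.map ℕₚ.<⇒≤ v<c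
      step : ∀ {z} → z ∈ v ∷ c → lookup σ z ∈ v ∷ c
      step z∈ with ∈-map⁻ proj₁ (subst (_ ∈_) (sym (sources-walkArcs v c v)) z∈)
      ... | az , az∈ , refl = subst (_∈ v ∷ c) (sym (All.lookup fol az∈))
        (∈-resp-↭ (↭-sym (∷↭∷ʳ v c)) (subst (_ ∈_) (targets-walkArcs v c v) (∈-map⁺ proj₂ az∈)))
      iter-∈ : ∀ k → iter σ k v ∈ v ∷ c
      iter-∈ zero = here refl
      iter-∈ (suc k) = step (iter-∈ k)

    -- From `z` the cycle leads to the smaller vertex `v` in at most `length c` steps, which is
    -- within the range that `isRep` tests.
    isRep-other : length c < n → All (λ z → isRep σ z ≡ false) c
    isRep-other |c|<n = All.tabulate other
      where
      other : ∀ {z} → z ∈ c → isRep σ z ≡ false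
      other {z} z∈ with reach fol z∈
      ... | k , k≤ , eq = allᵇ-false (∈-upTo⁺ (ℕₚ.≤-<-trans k≤ |c|<n)) not-≤
        where
        not-≤ : (toℕ z ≤ᵇ toℕ (iter σ k z)) ≡ false
        not-≤ rewrite eq with toℕ z ≤ᵇ toℕ v in z≤v
        ... | false = refl
        ... | true = contradiction (ℕₚ.≤ᵇ⇒≤ (toℕ z) (toℕ v) (Equivalence.from T-≡ z≤v))
                                   (ℕₚ.<⇒≱ (All.lookup v<c z∈))

    orbit-cycle : length c < n → orbit σ v ≡ v ∷ c
    orbit-cycle |c|<n with orbit-prefix c fol |c|<n
    ... | rest , eq = cong (v ∷_) (trans
      (cong (takeWhileᵇ (λ z → not (eqᶠ z v))) (trans (map-upTo (λ k → iter σ (suc k) v) n) eq))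
      (takeWhileᵇ-++ (All.map (λ v<z v≡z → ℕₚ.<⇒≢ v<z (cong toℕ v≡z)) v<c)))

  data IsOrbit : List (Fin n) → Set where
    is-orbit : ∀ {v c} → orbit σ v ≡ v ∷ c → Follows σ (walkArcs v c v) → IsOrbit (v ∷ c)

  -- As `S` is sorted, its first entry is the least element of its cycle and hence the
  -- representative. The filter drops the other entries of that cycle, and the rest `B` is again
  -- sorted.
  orbits : ∀ {S cs} → IsCycleList S cs → AllPairs Fin._<_ S → length S ≤ n →
    Follows σ (concatMap cycleArcs cs) → All IsOrbit cs × filterᵇ (isRep σ) S ≡ firsts cs
  orbits [] _ _ _ = [] , refl
  orbits {v ∷ S} {(v ∷ c) ∷ cs} (cycle {C = C} {B = B} i c↭C cl) (v<S ∷ sorted) |S|<n fol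
    with Allₚ.++⁻ (walkArcs v c v) fol
  ... | fol-c , fol-cs
    with orbits cl (AllPairs-Interleaving (swap i) sorted)
           (ℕₚ.≤-trans (ℕₚ.m≤n+m (length B) (length C))
             (subst (_≤ n) (Interleaving-length i) (ℕₚ.<⇒≤ |S|<n))) fol-cs
  ... | good , reps-B = is-orbit (orbit-cycle v<c fol-c |c|<n) fol-c ∷ good , reps-S
    where
    v<c : All (v Fin.<_) c
    v<c = All-resp-↭ (↭-sym c↭C) (All-Interleaving i v<S)
    |c|<n : length c < n
    |c|<n = ℕₚ.≤-<-trans (subst (_≤ length S) (sym (↭-length c↭C))
      (subst (length C ≤_) (sym (Interleaving-length i)) (ℕₚ.m≤m+n (length C) (length B)))) |S|<n
    reps-S : filterᵇ (isRep σ) (v ∷ S) ≡ v ∷ firsts cs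
    reps-S rewrite isRep-first v<c fol-c = cong (v ∷_) (trans
      (filterᵇ-Interleaving (isRep σ) i (All-resp-↭ c↭C (isRep-other v<c fol-c |c|<n))) reps-B)

  orbit-firsts : ∀ {cs} → All IsOrbit cs → map (orbit σ) (firsts cs) ≡ cs
  orbit-firsts [] = refl
  orbit-firsts (is-orbit eq _ ∷ good) = cong₂ _∷_ eq (orbit-firsts good)

allFin-sorted : (n : ℕ) → AllPairs Fin._<_ (allFin n)
allFin-sorted n = AllPairsₚ.tabulate⁺-< (λ i<j → i<j)

module _ {n : ℕ} {cs : List (List (Fin n))} (cl : IsCycleList (allFin n) cs) where
  open CycleOf (fromCycles cs)

  fromCycles-orbits : All IsOrbit cs × reps (fromCycles cs) ≡ firsts cs
  fromCycles-orbits = orbits cl (allFin-sorted n) (ℕₚ.≤-reflexive (length-allFin n)) (fromCycles-follows cl)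

  toCycles-fromCycles : toCycles (fromCycles cs) ≡ cs
  toCycles-fromCycles = trans (cong (map (orbit (fromCycles cs))) (proj₂ fromCycles-orbits))
    (orbit-firsts (proj₁ fromCycles-orbits))

-- The left inverse `toCycles` shows that no permutation is produced twice; equality of the two
-- counts then replaces a decomposition of an arbitrary permutation into cycles.
cycleLists↭listings : (n : ℕ) → map fromCycles (cycleLists n (allFin n)) ↭ listings n
cycleLists↭listings n = unique-⊆-↭ uniq sub (ℕₚ.≤-reflexive (begin
  length (listings n)                                ≡⟨ length-map toList (listings n) ⟨
  length (map toList (listings n))                   ≡⟨ ↭-length (listings↭perms n) ⟩
  length (perms (allFin n))
    ≡⟨ length-cycleLists n (allFin n) (Uniqueₚ.allFin⁺ n) (ℕₚ.≤-reflexive (length-allFin n)) ⟨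
  length (cycleLists n (allFin n))                   ≡⟨ length-map fromCycles (cycleLists n (allFin n)) ⟨
  length (map fromCycles (cycleLists n (allFin n)))  ∎))
  where
  open ≡.≡-Reasoning
  open Enumeration (_≟ᶠ_ {n})
  uniq : Unique (map fromCycles (cycleLists n (allFin n)))
  uniq = Uniqueₚ.map⁻ {f = toCycles} (subst Unique (sym (trans (sym (map-∘ (cycleLists n (allFin n))))
      (map-id-local (All.tabulate (λ cs∈ → toCycles-fromCycles (∈-cycleLists⁻ n (allFin n) cs∈))))))
    (cycleLists-unique n (Uniqueₚ.allFin⁺ n)))
  sub : map fromCycles (cycleLists n (allFin n)) ⊆ listings n
  sub σ∈ with ∈-map⁻ fromCycles σ∈
  ... | cs , cs∈ , refl = fromCycles-listing (∈-cycleLists⁻ n (allFin n) cs∈)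

-- Comparison of the two sides

module _ {c ℓ : Level} (R : CommutativeSemiring c ℓ) {n : ℕ} (D : Digraph n) (tournament : IsTournament D)
         {m : ℕ} (x : Fin m → CommutativeSemiring.Carrier R) where
  open CommutativeSemiring R hiding (zero; refl; sym; trans) renaming (Carrier to K)
  open CommutativeSemiring R using () renaming (refl to ≈-refl; sym to ≈-sym; trans to ≈-trans)
  open Eval R
  open ShuffleAlgebra R
  open FiniteSums R
  open EnumerationSums R
  open Colourings R D
  open Recursion tournament
  open import Algebra.Solver.Ring.NaturalCoefficients.Default R using (solve; _:+_; _:*_; _:=_; con)
  open import Relation.Binary.Reasoning.Setoid setoid

  -- Abstract in the cycle length and the D-cycle test, so that their values can be substituted
  -- by rewriting without unfolding the definitions.
  module _ (len : Fin n → ℕ) (dcycle : Fin n → Bool) where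

    restrictedTerm : List (Fin n) → K
    restrictedTerm vs =
      if allᵇ (λ i → if 1 <ᵇ len i then dcycle i else true) vs ∧ allᵇ isOdd (map len vs)
      then natR (2 ^ length (filterᵇ (λ k → 1 <ᵇ k) (map len vs))) * pType x (map len vs)
      else 0#

    -- The arc condition, the parity condition, the power of 2 and the power sums are all
    -- multiplicative over cycles, so one cycle contributes one factor.
    restrictedTerm-∷ : ∀ v c vs → len v ≡ suc (length c) → dcycle v ≡ isWalk D v c v →
      restrictedTerm (v ∷ vs) ≈ cycleTerm x (v ∷ c) * restrictedTerm vs
    -- A cycle of length 1 is odd, exempt from the arc condition and not counted by `ψ`, so its
    -- contribution is `p x 1`.
    restrictedTerm-∷ v [] vs len≡ _ rewrite len≡
      with allᵇ (λ i → if 1 <ᵇ len i then dcycle i else true) vs | allᵇ isOdd (map len vs)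
    ... | true | true = solve 3 (λ a b c → a :* (b :* c) := (con 1 :+ con 0) :* b :* (a :* c)) ≈-refl _ _ _
    ... | true | false = ≈-sym (zeroʳ _)
    ... | false | _ = ≈-sym (zeroʳ _)
    restrictedTerm-∷ v (y ∷ c) vs len≡ dcycle≡ rewrite len≡ | dcycle≡
      with D v y ∧ isWalk D y c v | not (not (isOdd (length c)))
         | allᵇ (λ i → if 1 <ᵇ len i then dcycle i else true) vs
    ... | false | true | _ = ≈-sym (≈-trans (*-congʳ (zeroˡ _)) (zeroˡ _))
    ... | false | false | _ = ≈-sym (≈-trans (*-congʳ (zeroˡ _)) (zeroˡ _))
    ... | true | false | true = ≈-sym (≈-trans (*-congʳ (zeroˡ _)) (zeroˡ _))
    ... | true | false | false = ≈-sym (≈-trans (*-congʳ (zeroˡ _)) (zeroˡ _))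
    ... | true | true | false = ≈-sym (zeroʳ _)
    ... | true | true | true with allᵇ isOdd (map len vs)
    ...   | false = ≈-sym (zeroʳ _)
    -- A further nontrivial cycle raises the exponent of 2 by one, which supplies the 2 in
    -- `cycleWeight`.
    ...   | true = ≈-trans (*-congʳ (natR-* 2 (2 ^ length (filterᵇ (λ k → 1 <ᵇ k) (map len vs)))))
                     (solve 4 (λ t a b c → t :* a :* (b :* c) := t :* b :* (a :* c)) ≈-refl _ _ _ _)

  permutationTerm : Vec (Fin n) n → List (Fin n) → K
  permutationTerm σ = restrictedTerm (cycLen σ) (isDCycle D σ)

  permutationTerm-firsts : ∀ σ {cs} → All (CycleOf.IsOrbit σ) cs →
    permutationTerm σ (firsts cs) ≈ prodR (map (cycleTerm x) cs)
  permutationTerm-firsts σ [] = ≈-trans (*-congʳ natR-1) (*-identityˡ 1#)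
  permutationTerm-firsts σ {(v ∷ c) ∷ cs} (CycleOf.is-orbit eq fol ∷ good) =
    ≈-trans (restrictedTerm-∷ (cycLen σ) (isDCycle D σ) v c (firsts cs) (cong length eq)
              (trans (cong (λ k → allᵇ (λ j → D (iter σ j v) (iter σ (suc j) v)) (upTo k)) (cong length eq))
                     (CycleOf.isDCycle-walk σ D v c v fol)))
            (*-congˡ (permutationTerm-firsts σ good))

  RHS-cycleLists : RHS D x ≈ ∑ (λ cs → prodR (map (cycleTerm x) cs)) (cycleLists n (allFin n))
  RHS-cycleLists = begin
    RHS D x
      ≈⟨ ∑-filterᵇ _ _ (listings n) ⟩
    ∑ (λ σ → permutationTerm σ (reps σ)) (listings n)
      ≈⟨ ∑-↭ _ (cycleLists↭listings n) ⟨
    ∑ (λ σ → permutationTerm σ (reps σ)) (map fromCycles (cycleLists n (allFin n)))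
      ≡⟨ ∑-map _ fromCycles (cycleLists n (allFin n)) ⟩
    ∑ (λ cs → permutationTerm (fromCycles cs) (reps (fromCycles cs))) (cycleLists n (allFin n))
      ≈⟨ ∑-cong-∈ (cycleLists n (allFin n)) (λ cs cs∈ →
           let good , reps≡ = fromCycles-orbits (∈-cycleLists⁻ n (allFin n) cs∈) in
           ≈-trans (reflexive (cong (permutationTerm (fromCycles cs)) reps≡))
                   (permutationTerm-firsts (fromCycles cs) good)) ⟩
    _ ∎

  U-permSum : U D x ≈ Û x (allFin n)
  U-permSum = begin
    U D x
      ≈⟨ ∑-cong (L-blockSum x) (listings n) ⟩
    ∑ (λ w → blockSum x (toList w)) (listings n)
      ≡⟨ ∑-map (blockSum x) toList (listings n) ⟨
    ∑ (blockSum x) (map toList (listings n))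
      ≈⟨ ∑-↭ (blockSum x) (listings↭perms n) ⟩
    ∑ (blockSum x) (perms (allFin n))
      ≈⟨ permSum-perms (blockSum x) (allFin n) ⟨
    Û x (allFin n) ∎

  U≈RHS : U D x ≈ RHS D x
  U≈RHS = begin
    U D x
      ≈⟨ U-permSum ⟩
    Û x (allFin n)
      ≈⟨ ∑-cycleLists (cycleTerm x) (Û x) (Û-[] x) (Û-cycleTerm x) n (allFin n)
           (Uniqueₚ.allFin⁺ n) (ℕₚ.≤-reflexive (length-allFin n)) ⟩
    ∑ (λ cs → prodR (map (cycleTerm x) cs)) (cycleLists n (allFin n))
      ≈⟨ RHS-cycleLists ⟨
    RHS D x ∎

theorem1p39 : {c ℓ : Level} (R : CommutativeSemiring c ℓ) (n : ℕ) (D : Digraph n) →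
    IsTournament D → (m : ℕ) (x : Fin m → CommutativeSemiring.Carrier R) →
    CommutativeSemiring._≈_ R (Eval.U R D x) (Eval.RHS R D x)
theorem1p39 R n D tournament m x = U≈RHS R D tournament x
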